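{- Every cubical $4$-polytope is strongly $2$-linked; that is, for every set $X$ of five vertices of its graph and every labelling and pairing $\{\{s_1,t_1\},\{s_2,t_2\}\}$ of four of the vertices of $X$, with $x$ the remaining vertex of $X$, there exist vertex-disjoint paths $L_1$ from $s_1$ to $t_1$ and $L_2$ from $s_2$ to $t_2$ in the graph of the polytope, neither of which contains $x$.
   Context: A cubical polytope is a polytope all of whose facets are combinatorially equivalent to cubes. The graph of a polytope consists of its vertices and edges. -}

module Defs where

open import Data.Nat using (ℕ; zero; suc)
open import Data.Fin using (Fin; zero; suc)
open import Data.Bool using (Bool)
open import Data.Vec using (Vec; lookup)
open import Data.Maybe using (Maybe; just)
open import Data.List using (List; []; _∷_)
open import Data.List.Membership.Propositional using (_∈_; _∉_)
open import Data.List.Relation.Unary.Unique.Propositional using (Unique)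
open import Data.Product using (Σ; ∃; _×_; _,_)
open import Data.Sum using (_⊎_)
open import Data.Empty using (⊥)
open import Relation.Nullary using (¬_)
open import Relation.Binary.PropositionalEquality using (_≡_; _≢_)
open import Relation.Binary.Structures using (IsStrictTotalOrder)
open import Algebra.Structures using (IsCommutativeRing)
open import Function.Bundles using (_⇔_)

record OrderedField : Set₁ where
  infixl 6 _+_
  infixl 7 _*_
  infix 4 _<_ _≤_
  field
    Carrier : Set
    _+_ _*_ : Carrier → Carrier → Carrier
    -_      : Carrier → Carrier
    0# 1#   : Carrier
    _<_     : Carrier → Carrier → Set
    isCommutativeRing : IsCommutativeRing _≡_ _+_ _*_ -_ 0# 1#
    0≢1     : 0# ≢ 1#
    inverse : ∀ x → x ≢ 0# → ∃ λ y → x * y ≡ 1#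
    isStrictTotalOrder : IsStrictTotalOrder _≡_ _<_
    +-mono-< : ∀ {x y} z → x < y → x + z < y + z
    *-pos    : ∀ {x y} → 0# < x → 0# < y → 0# < x * y

  _≤_ : Carrier → Carrier → Set
  x ≤ y = x < y ⊎ x ≡ y

module Geometry (F : OrderedField) where
  open OrderedField F

  Point : Set
  Point = Fin 4 → Carrier

  dot : ∀ {d} → (Fin d → Carrier) → (Fin d → Carrier) → Carrier
  dot {zero}  a b = 0#
  dot {suc d} a b = a zero * b zero + dot (λ k → a (suc k)) (λ k → b (suc k))

  -- The polytope P = conv {p 0, …, p (n-1)}.
  -- A set S of indices (given as a predicate) is (the vertex set of) a face
  -- of P if some valid inequality  a·x ≤ b  for P is tight exactly on S.
  IsFace : ∀ {n} → (Fin n → Point) → (Fin n → Set) → Set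
  IsFace {n} p S =
    Σ Point λ a → Σ Carrier λ b →
      (∀ i → dot a (p i) ≤ b) × (∀ i → S i ⇔ (dot a (p i) ≡ b))

  IsFacet : ∀ {n} → (Fin n → Point) → (Fin n → Set) → Set₁
  IsFacet {n} p S =
    IsFace p S × (∃ λ i → ¬ S i) ×
    (∀ T → IsFace p T → (∀ i → S i → T i) →
       (∀ i → T i → S i) ⊎ (∀ i → T i))

  AreVertices : ∀ {n} → (Fin n → Point) → Set
  AreVertices {n} p = ∀ i → IsFace p (λ k → k ≡ i)

  FullDim : ∀ {n} → (Fin n → Point) → Set
  FullDim {n} p = ∀ (a : Point) b → (∀ i → dot a (p i) ≡ b) → ∀ k → a k ≡ 0#

  -- Faces of the (combinatorial) 3-cube with vertex set {0,1}³:
  -- the empty face, and for each partial assignment σ of coordinates the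
  -- set of vertices agreeing with σ.
  IsCubeFace : (Vec Bool 3 → Set) → Set
  IsCubeFace C =
    (∀ v → ¬ C v) ⊎
    (Σ (Fin 3 → Maybe Bool) λ σ →
       ∀ v → C v ⇔ (∀ j c → σ j ≡ just c → lookup v j ≡ c))

  -- A facet S is combinatorially equivalent to the 3-cube: a bijection g
  -- from the cube's vertices onto the vertices of S identifying the faces
  -- of the cube with the faces of P contained in S (= the faces of S).
  CubeEquivalent : ∀ {n} → (Fin n → Point) → (Fin n → Set) → Set₁
  CubeEquivalent {n} p S =
    Σ (Vec Bool 3 → Fin n) λ g →
      (∀ u v → g u ≡ g v → u ≡ v) ×
      (∀ v → S (g v)) ×
      (∀ i → S i → ∃ λ v → g v ≡ i) ×
      (∀ T → IsFace p T → (∀ i → T i → S i) → IsCubeFace (λ v → T (g v))) ×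
      (∀ C → IsCubeFace C → IsFace p (λ i → ∃ λ v → C v × g v ≡ i))

  IsCubical4Polytope : ∀ {n} → (Fin n → Point) → Set₁
  IsCubical4Polytope p =
    AreVertices p × FullDim p × (∀ S → IsFacet p S → CubeEquivalent p S)

  Adj : ∀ {n} → (Fin n → Point) → Fin n → Fin n → Set
  Adj p i j = i ≢ j × IsFace p (λ k → k ≡ i ⊎ k ≡ j)

data Walk {n : ℕ} (E : Fin n → Fin n → Set) : Fin n → Fin n → Set where
  stop : ∀ v → Walk E v v
  step : ∀ u {v w} → E u v → Walk E v w → Walk E u w

verts : ∀ {n} {E : Fin n → Fin n → Set} {s t} → Walk E s t → List (Fin n)
verts (stop v)       = v ∷ []
verts (step u _ w)   = u ∷ verts w

Path : ∀ {n} → (Fin n → Fin n → Set) → Fin n → Fin n → Set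
Path E s t = Σ (Walk E s t) λ w → Unique (verts w)

Disjoint : ∀ {n} → List (Fin n) → List (Fin n) → Set
Disjoint xs ys = ∀ {v} → v ∈ xs → v ∈ ys → ⊥

{-# OPTIONS --safe #-}
module Submission where

-- Let X = {s₁, t₁, s₂, t₂, x}. For any affine functional φ the vertices with φ > 0 induce a connected
-- subgraph, and a vertex with φ = 0 has a neighbour in it unless φ ≤ 0 throughout. So if a hyperplane
-- through x and three of the other points cuts P, then one pair is joined on one side of it and the
-- other pair on the other side. Otherwise the four hyperplanes through x and three other points
-- support P, and each of the faces cut out lies in a facet.
--   If a facet contains X, it is a cube, and one of the pairs can be joined in its graph without
-- meeting x or the other pair; the other pair is joined through the vertices outside the facet.
--   If not, there are four facets, each missing a different point of X ∖ {x}. Their pairwise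
-- intersections force s₁, t₁, s₂, t₂ to be neighbours of x spanning squares with it, and the corners
-- opposite to x in the squares of s₁, t₁ and of s₂, t₂ give the two paths.

-- The five vertices may be affinely dependent: a hyperplane through `x` and three others need not
-- be unique and may contain all of X, which is why a facet found from it can do so too. When it
-- cuts the polytope, at most one end of one pair lies off it. That pair takes the open side facing
-- this end, the other pair takes the opposite side, and `x` belongs to neither. The field is an
-- arbitrary ordered field, so finite maxima of ratios and induction on vertex sets replace
-- topological arguments. The common tool is the rotation of a supporting hyperplane until it
-- touches a new vertex. Started at a hyperplane exposing a vertex, it yields the improving step of
-- the simplex method, and hence edges and connectivity; started at any supporting hyperplane, it
-- enlarges a face until the face is a facet. With four facets each missing one end, the other three
-- cut any one of them in faces through `x` that each omit a different one of its three ends; in a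
-- cube this leaves only the three squares at `x`.

open import Defs
open import Algebra.Bundles using (CommutativeRing; RawRing)
import Algebra.Solver.Ring
open import Algebra.Solver.Ring.AlmostCommutativeRing using (_-Raw-AlmostCommutative⟶_; fromCommutativeRing)
open import Data.Bool as Bool using (Bool; true; false; not; _∨_; _xor_; T)
open import Data.Bool.Properties using (not-¬; T?; xor-assoc; xor-same; not-distribʳ-xor; xor-identityʳ)
open import Data.Empty using (⊥-elim)
open import Data.Fin using (Fin; zero; suc; punchIn; punchOut) renaming (_≟_ to _≟ᶠ_)
open import Data.Fin.Induction using (spo-noetherian)
open import Data.Fin.Properties using (any?; punchIn-punchOut; all?)
open import Data.Fin.Subset using (Subset; _⊂_; _⊃_) renaming (_∈_ to _∈ₛ_)
open import Data.Fin.Subset.Induction using (⊂-wellFounded; ⊃-wellFounded; Acc; acc)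
open import Data.List using (List; []; _∷_; length; map; filter; allFin)
import Data.List.Extrema as Extrema
import Data.List.Membership.DecPropositional as DecMembership
open import Data.List.Membership.Propositional using (_∈_; _∉_)
open import Data.List.Membership.Propositional.Properties using (∈-filter⁺; ∈-allFin; ∈-map⁺; ∈-map⁻)
open import Data.List.Properties using (length-map)
open import Data.List.Relation.Unary.All as All using (All; []; _∷_)
import Data.List.Relation.Unary.All.Properties as Allₚ
open import Data.List.Relation.Unary.AllPairs using ([]; _∷_)
open import Data.List.Relation.Unary.Any using (here; there)
open import Data.List.Relation.Unary.Unique.Propositional using (Unique)
open import Data.Maybe as Maybe using (Maybe; just; nothing; is-just; _<∣>_)
open import Data.Nat as ℕ using (ℕ; zero; suc; s≤s; z≤n)
open import Data.Nat.Properties using (m≤n⇒m≤1+n)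
open import Data.Product using (Σ; ∃; _×_; _,_; proj₁; proj₂; ∃₂)
open import Data.Sum as Sum using (_⊎_; inj₁; inj₂; [_,_]; swap)
open import Data.Unit using (tt)
open import Data.Vec using (tabulate; Vec; []; _∷_; lookup; updateAt; zipWith)
open import Data.Vec.Functional using (insertAt)
open import Data.Vec.Functional.Properties using (insertAt-lookup; insertAt-punchIn)
open import Data.Vec.Properties using
  (lookup∘tabulate; []=⇒lookup; lookup⇒[]=; lookup∘updateAt; lookup∘updateAt′; ≡-dec; zipWith-identityʳ)
open import Function using (_∘_; mk⇔; id)
open import Function.Bundles using (_⇔_; module Equivalence)
open import Relation.Binary.Bundles using (StrictTotalOrder; TotalOrder)
import Relation.Binary.Construct.On as On
open import Relation.Binary.Definitions using (tri<; tri≈; tri>)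
import Relation.Binary.Properties.StrictTotalOrder as STO
open import Relation.Binary.Structures using (IsStrictTotalOrder; IsStrictPartialOrder)
open import Relation.Nullary using (¬_; Dec; yes; no; does)
open import Relation.Nullary.Decidable using
  (¬?; decidable-stable; dec-true; _×-dec_; map′; toWitness; _→-dec_; _⊎-dec_)
open import Relation.Nullary.Negation using (contradiction)
open import Relation.Unary using (Decidable)
import Relation.Binary.PropositionalEquality as ≡
open ≡ using (_≡_; _≢_)

-- The library's ring solvers decide equality of coefficients in the ring itself, which is
-- useless in an abstract ring; here the coefficients (m , n) denote the integers m − n.
module IntegerSolver {c ℓ} (R : CommutativeRing c ℓ) where
  open CommutativeRing R
  open import Algebra.Properties.Semiring.Mult semiring renaming (_×_ to _×ᵣ_)
  open import Algebra.Properties.Ring ring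
  open import Algebra.Properties.AbelianGroup +-abelianGroup using (⁻¹-∙-comm)
  open import Algebra.Properties.CommutativeSemigroup +-commutativeSemigroup using (interchange)
  open import Relation.Binary.Reasoning.Setoid setoid

  differences : RawRing _ _
  differences = record
    { Carrier = ℕ × ℕ
    ; _≈_ = _≡_
    ; _+_ = λ (a , b) (c , d) → (a ℕ.+ c) , (b ℕ.+ d)
    ; _*_ = λ (a , b) (c , d) → (a ℕ.* c ℕ.+ b ℕ.* d) , (a ℕ.* d ℕ.+ b ℕ.* c)
    ; -_ = λ (a , b) → b , a
    ; 0# = 0 , 0
    ; 1# = 1 , 0
    }

  diff : ℕ × ℕ → Carrier
  diff (a , b) = a ×ᵣ 1# - b ×ᵣ 1#

  diff-+ : ∀ A B C D → (A + C) - (B + D) ≈ (A - B) + (C - D)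
  diff-+ A B C D = begin
    (A + C) - (B + D)         ≈⟨ +-congˡ (⁻¹-∙-comm B D) ⟨
    (A + C) + (- B - D)       ≈⟨ interchange A C (- B) (- D) ⟩
    (A - B) + (C - D)         ∎

  diff-* : ∀ A B C D → (A * C + B * D) - (A * D + B * C) ≈ (A - B) * (C - D)
  diff-* A B C D = begin
    (A * C + B * D) - (A * D + B * C)         ≈⟨ diff-+ (A * C) (A * D) (B * D) (B * C) ⟩
    (A * C - A * D) + (B * D - B * C)
      ≈⟨ +-cong (+-congˡ (sym (-‿distribʳ-* A D))) (+-cong (-‿involutive (B * D)) (sym (-‿distribˡ-* B C))) ⟨
    (A * C + A * - D) + (- - (B * D) + - B * C)
      ≈⟨ +-cong (distribˡ A C (- D)) (trans (+-comm _ _) (+-congʳ (trans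
            (sym (-‿distribʳ-* (- B) D)) (-‿cong (sym (-‿distribˡ-* B D)))))) ⟨
    A * (C - D) + (- B * C + - B * - D)       ≈⟨ +-congˡ (distribˡ (- B) C (- D)) ⟨
    A * (C - D) + - B * (C - D)               ≈⟨ distribʳ (C - D) A (- B) ⟨
    (A - B) * (C - D)                         ∎

  morphism : differences -Raw-AlmostCommutative⟶ fromCommutativeRing R
  morphism = record
    { ⟦_⟧ = diff
    ; +-homo = λ (a , b) (c , d) → trans
        (+-cong (×-homo-+ 1# a c) (-‿cong (×-homo-+ 1# b d)))
        (diff-+ (a ×ᵣ 1#) (b ×ᵣ 1#) (c ×ᵣ 1#) (d ×ᵣ 1#))
    ; *-homo = λ (a , b) (c , d) → trans
        (+-cong (sum a c b d) (-‿cong (sum a d b c)))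
        (diff-* (a ×ᵣ 1#) (b ×ᵣ 1#) (c ×ᵣ 1#) (d ×ᵣ 1#))
    ; -‿homo = λ (a , b) → sym (trans (sym (⁻¹-∙-comm _ _)) (trans (+-comm _ _) (+-congʳ (-‿involutive _))))
    ; 0-homo = -‿inverseʳ 0#
    ; 1-homo = trans (+-cong (+-identityʳ 1#) -0#≈0#) (+-identityʳ 1#)
    }
    where
    sum : ∀ a c b d → (a ℕ.* c ℕ.+ b ℕ.* d) ×ᵣ 1# ≈ a ×ᵣ 1# * c ×ᵣ 1# + b ×ᵣ 1# * d ×ᵣ 1#
    sum a c b d = trans (×-homo-+ 1# (a ℕ.* c) (b ℕ.* d)) (+-cong (×1-homo-* a c) (×1-homo-* b d))

  diff-≈ : ∀ x y → Maybe (diff x ≈ diff y)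
  diff-≈ (a , b) (c , d) with a ℕ.+ d ℕ.≟ c ℕ.+ b
  ... | no _ = nothing
  ... | yes eq = just (begin
    A - B             ≈⟨ +-identityʳ _ ⟨
    A - B + 0#        ≈⟨ +-congˡ (-‿inverseʳ D) ⟨
    A - B + (D - D)   ≈⟨ interchange A (- B) D (- D) ⟩
    A + D + (- B - D) ≈⟨ +-congʳ (trans (sym (×-homo-+ 1# a d)) (trans (×-congˡ eq) (×-homo-+ 1# c b))) ⟩
    C + B + (- B - D) ≈⟨ +-assoc C B (- B - D) ⟩
    C + (B + (- B - D)) ≈⟨ +-congˡ (+-assoc B (- B) (- D)) ⟨
    C + (B - B - D)   ≈⟨ +-congˡ (+-congʳ (-‿inverseʳ B)) ⟩
    C + (0# - D)      ≈⟨ +-congˡ (+-identityˡ (- D)) ⟩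
    C - D             ∎)
    where
    A = a ×ᵣ 1#
    B = b ×ᵣ 1#
    C = c ×ᵣ 1#
    D = d ×ᵣ 1#

  open Algebra.Solver.Ring differences (fromCommutativeRing R) morphism diff-≈ public
    using (solve; _:=_; _:+_; _:*_; :-_)

open ≡ using (refl; sym; trans; cong; cong₂; subst; subst₂; module ≡-Reasoning)

-- Arithmetic in ordered fields

module FieldProperties (F : OrderedField) where
  open OrderedField F
  open IsStrictTotalOrder isStrictTotalOrder public
    using (compare; irrefl; _≟_; _<?_) renaming (trans to <-trans)

  commutativeRing : CommutativeRing _ _
  commutativeRing = record { isCommutativeRing = isCommutativeRing }

  open CommutativeRing commutativeRing using (+-identityˡ; +-identityʳ; -‿inverseʳ; zeroˡ; zeroʳ; +-comm; *-identityˡ)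

  open import Algebra.Properties.Ring (CommutativeRing.ring commutativeRing) using (-0#≈0#) public
  open IntegerSolver commutativeRing public using (solve; _:=_; _:+_; _:*_; :-_)

  <-irrefl : ∀ {x} → ¬ x < x
  <-irrefl = irrefl refl

  <-≤-trans : ∀ {x y z} → x < y → y ≤ z → x < z
  <-≤-trans p (inj₁ q)    = <-trans p q
  <-≤-trans p (inj₂ refl) = p

  ≤-<-trans : ∀ {x y z} → x ≤ y → y < z → x < z
  ≤-<-trans (inj₁ p)    q = <-trans p q
  ≤-<-trans (inj₂ refl) q = q

  ≮⇒≥ : ∀ {x y} → ¬ x < y → y ≤ x
  ≮⇒≥ {x} {y} x≮y with compare x y
  ... | tri< x<y _ _ = contradiction x<y x≮y
  ... | tri≈ _ x≡y _ = inj₂ (sym x≡y)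
  ... | tri> _ _ y<x = inj₁ y<x

  ≤∧≢⇒< : ∀ {x y} → x ≤ y → x ≢ y → x < y
  ≤∧≢⇒< (inj₁ x<y) _   = x<y
  ≤∧≢⇒< (inj₂ x≡y) x≢y = contradiction x≡y x≢y

  <⇒≢ : ∀ {x y} → x < y → x ≢ y
  <⇒≢ x<y refl = <-irrefl x<y

  <⇒≱ : ∀ {x y} → x < y → ¬ y ≤ x
  <⇒≱ x<y y≤x = <-irrefl (<-≤-trans x<y y≤x)

  +-monoʳ-< : ∀ {x y} z → x < y → z + x < z + y
  +-monoʳ-< {x} {y} z x<y = subst₂ _<_ (+-comm x z) (+-comm y z) (+-mono-< z x<y)

  neg-pos : ∀ {x} → x < 0# → 0# < - x
  neg-pos {x} x<0 = subst₂ _<_ (-‿inverseʳ x) (+-identityˡ (- x)) (+-mono-< (- x) x<0)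

  neg-neg : ∀ {x} → 0# < x → - x < 0#
  neg-neg {x} 0<x = subst₂ _<_ (+-identityˡ (- x)) (-‿inverseʳ x) (+-mono-< (- x) 0<x)

  neg-involutive : ∀ x → - (- x) ≡ x
  neg-involutive = solve 1 (λ x → :- (:- x) := x) refl

  0<-⇒<0 : ∀ {x} → 0# < - x → x < 0#
  0<-⇒<0 {x} p = subst (_< 0#) (neg-involutive x) (neg-neg p)

  x<y⇒x-y<0 : ∀ {x y} → x < y → x + - y < 0#
  x<y⇒x-y<0 {x} {y} x<y = subst (x + - y <_) (-‿inverseʳ y) (+-mono-< (- y) x<y)

  x-y<0⇒x<y : ∀ {x y} → x + - y < 0# → x < y
  x-y<0⇒x<y {x} {y} p = subst₂ _<_ (eq x y) (+-identityˡ y) (+-mono-< y p)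
    where
    eq : ∀ x y → x + - y + y ≡ x
    eq = solve 2 (λ x y → x :+ :- y :+ y := x) refl

  x-y≡0⇒x≡y : ∀ {x y} → x + - y ≡ 0# → x ≡ y
  x-y≡0⇒x≡y {x} {y} p = trans (eq x y) (trans (cong (_+ y) p) (+-identityˡ y))
    where
    eq : ∀ x y → x ≡ x + - y + y
    eq = solve 2 (λ x y → x := x :+ :- y :+ y) refl

  neg+nonpos : ∀ {x y} → x < 0# → y ≤ 0# → x + y < 0#
  neg+nonpos {x} {y} x<0 (inj₁ y<0) =
    <-trans (subst (x + y <_) (+-identityʳ x) (+-monoʳ-< x y<0)) x<0
  neg+nonpos {x} x<0 (inj₂ refl) = subst (_< 0#) (sym (+-identityʳ x)) x<0

  pos*neg : ∀ {x y} → 0# < x → y < 0# → x * y < 0#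
  pos*neg {x} {y} 0<x y<0 = 0<-⇒<0 (subst (0# <_) (eq x y) (*-pos 0<x (neg-pos y<0)))
    where
    eq : ∀ x y → x * (- y) ≡ - (x * y)
    eq = solve 2 (λ x y → x :* (:- y) := :- (x :* y)) refl

  nonneg*nonpos : ∀ {x y} → 0# ≤ x → y ≤ 0# → x * y ≤ 0#
  nonneg*nonpos (inj₁ 0<x) (inj₁ y<0) = inj₁ (pos*neg 0<x y<0)
  nonneg*nonpos {x} (inj₁ 0<x) (inj₂ refl) = inj₂ (zeroʳ x)
  nonneg*nonpos {y = y} (inj₂ refl) _ = inj₂ (zeroˡ y)

  pos*-cancel-pos : ∀ {x y} → 0# < x → 0# < x * y → 0# < y
  pos*-cancel-pos {x} {y} 0<x 0<xy with compare y 0#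
  ... | tri< y<0 _ _ = ⊥-elim (<-irrefl (<-trans 0<xy (pos*neg 0<x y<0)))
  ... | tri≈ _ refl _ = ⊥-elim (<-irrefl (subst (0# <_) (zeroʳ x) 0<xy))
  ... | tri> _ _ 0<y = 0<y

  x*y≡0⇒y≡0 : ∀ {x y} → x ≢ 0# → x * y ≡ 0# → y ≡ 0#
  x*y≡0⇒y≡0 {x} {y} x≢0 xy≡0 with inverse x x≢0
  ... | x⁻¹ , xx⁻¹≡1 = begin
    y               ≡⟨ *-identityˡ y ⟨
    1# * y          ≡⟨ cong (_* y) xx⁻¹≡1 ⟨
    x * x⁻¹ * y     ≡⟨ eq x x⁻¹ y ⟩
    x⁻¹ * (x * y)   ≡⟨ cong (x⁻¹ *_) xy≡0 ⟩
    x⁻¹ * 0#        ≡⟨ zeroʳ x⁻¹ ⟩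
    0#              ∎
    where
    open ≡-Reasoning
    eq : ∀ x z y → x * z * y ≡ z * (x * y)
    eq = solve 3 (λ x z y → x :* z :* y := z :* (x :* y)) refl

  0<1 : 0# < 1#
  0<1 with compare 0# 1#
  ... | tri< 0<1 _ _ = 0<1
  ... | tri≈ _ 0≡1 _ = contradiction 0≡1 0≢1
  ... | tri> _ _ 1<0 = contradiction
    (<-trans 1<0 (subst (0# <_) (trans (eq 1#) (*-identityˡ 1#)) (*-pos (neg-pos 1<0) (neg-pos 1<0)))) <-irrefl
    where
    eq : ∀ x → (- x) * (- x) ≡ x * x
    eq = solve 1 (λ x → (:- x) :* (:- x) := x :* x) refl

  -- The default value 0 at 0 lets ratios be formed over all vertices before their denominators are
  -- known to be nonzero.
  inv : Carrier → Carrier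
  inv x with x ≟ 0#
  ... | yes _  = 0#
  ... | no x≢0 = proj₁ (inverse x x≢0)

  inv-inverseʳ : ∀ {x} → x ≢ 0# → x * inv x ≡ 1#
  inv-inverseʳ {x} x≢0 with x ≟ 0#
  ... | yes x≡0 = contradiction x≡0 x≢0
  ... | no x≢0′ = proj₂ (inverse x x≢0′)

  _≤?_ : ∀ x y → Dec (x ≤ y)
  x ≤? y with y <? x
  ... | yes y<x = no (<⇒≱ y<x)
  ... | no y≮x  = yes (≮⇒≥ y≮x)

  strictTotalOrder : StrictTotalOrder _ _ _
  strictTotalOrder = record { isStrictTotalOrder = isStrictTotalOrder }

  totalOrder : TotalOrder _ _ _
  totalOrder = STO.totalOrder strictTotalOrder

-- Kernels of linear systems by elimination

module LinearAlgebra (F : OrderedField) where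
  open OrderedField F
  open Geometry F using (dot)
  open FieldProperties F
  open CommutativeRing commutativeRing using (+-identityˡ; +-identityʳ; zeroˡ; zeroʳ; *-comm; *-identityˡ; -‿inverseʳ)

  dot-cong : ∀ {d} {u v x : Fin d → Carrier} → (∀ k → u k ≡ v k) → dot u x ≡ dot v x
  dot-cong {zero}          u≗v = refl
  dot-cong {suc d} {x = x} u≗v =
    cong₂ _+_ (cong (_* x zero) (u≗v zero)) (dot-cong (λ k → u≗v (suc k)))

  dot-zero : ∀ {d} {u : Fin d → Carrier} x → (∀ k → u k ≡ 0#) → dot u x ≡ 0#
  dot-zero {zero}  x u≗0 = refl
  dot-zero {suc d} x u≗0 = trans
    (cong₂ _+_ (trans (cong (_* x zero) (u≗0 zero)) (zeroˡ (x zero))) (dot-zero (x ∘ suc) (λ k → u≗0 (suc k))))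
    (+-identityˡ 0#)

  dot-comm : ∀ {d} (u x : Fin d → Carrier) → dot u x ≡ dot x u
  dot-comm {zero}  u x = refl
  dot-comm {suc d} u x = cong₂ _+_
    (*-comm (u zero) (x zero))
    (dot-comm (u ∘ suc) (x ∘ suc))

  comb : ∀ {d} → Carrier → (Fin d → Carrier) → Carrier → (Fin d → Carrier) → (Fin d → Carrier)
  comb α u β v k = α * u k + β * v k

  dot-comb : ∀ {d} α (u : Fin d → Carrier) β v x → dot (comb α u β v) x ≡ α * dot u x + β * dot v x
  dot-comb {zero}  α u β v x = sym (trans (cong₂ _+_ (zeroʳ α) (zeroʳ β)) (+-identityˡ 0#))
  dot-comb {suc d} α u β v x = trans
    (cong ((α * u zero + β * v zero) * x zero +_) (dot-comb α (u ∘ suc) β (v ∘ suc) (x ∘ suc)))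
    (solve 7 (λ α a β b x s t → (α :* a :+ β :* b) :* x :+ (α :* s :+ β :* t)
                             := α :* (a :* x :+ s) :+ β :* (b :* x :+ t)) refl
      α (u zero) β (v zero) (x zero) (dot (u ∘ suc) (x ∘ suc)) (dot (v ∘ suc) (x ∘ suc)))

  dot-combʳ : ∀ {d} α β (u x y : Fin d → Carrier) → dot u (comb α x β y) ≡ α * dot u x + β * dot u y
  dot-combʳ α β u x y = trans (dot-comm u (comb α x β y)) (trans (dot-comb α x β y u)
    (cong₂ _+_ (cong (α *_) (dot-comm x u)) (cong (β *_) (dot-comm y u))))

  dot-punchIn : ∀ {d} (k : Fin (suc d)) u x → dot u x ≡ u k * x k + dot (u ∘ punchIn k) (x ∘ punchIn k)
  dot-punchIn         zero    u x = refl
  dot-punchIn {suc d} (suc k) u x = trans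
    (cong (u zero * x zero +_) (dot-punchIn k (u ∘ suc) (x ∘ suc)))
    (solve 3 (λ a b c → a :+ (b :+ c) := b :+ (a :+ c)) refl
      (u zero * x zero) (u (suc k) * x (suc k)) (dot (u ∘ suc ∘ punchIn k) (x ∘ suc ∘ punchIn k)))

  -- The row operation `r k` times `x` minus `x k` times `r`, done without division; its entry at
  -- `k` cancels, so that column is dropped.
  eliminate : ∀ {d} → Fin (suc d) → (r x : Fin (suc d) → Carrier) → Fin d → Carrier
  eliminate k r x = comb (r k) (x ∘ punchIn k) (- x k) (r ∘ punchIn k)

  dot-eliminate : ∀ {d} (k : Fin (suc d)) r x u → dot u r ≡ 0# →
                  dot (u ∘ punchIn k) (eliminate k r x) ≡ r k * dot u x
  dot-eliminate k r x u u·r≡0 = begin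
    dot u′ (eliminate k r x)
      ≡⟨ dot-combʳ (r k) (- x k) u′ (x ∘ punchIn k) (r ∘ punchIn k) ⟩
    r k * X + (- x k) * R
      ≡⟨ solve 5 (λ r x u X R → r :* X :+ (:- x) :* R := r :* (u :* x :+ X) :+ (:- x) :* (u :* r :+ R))
           refl (r k) (x k) (u k) X R ⟩
    r k * (u k * x k + X) + (- x k) * (u k * r k + R)
      ≡⟨ cong₂ (λ s t → r k * s + (- x k) * t) (sym (dot-punchIn k u x))
           (trans (sym (dot-punchIn k u r)) u·r≡0) ⟩
    r k * dot u x + (- x k) * 0#
      ≡⟨ trans (cong (r k * dot u x +_) (zeroʳ (- x k))) (+-identityʳ _) ⟩
    r k * dot u x ∎
    where
    open ≡-Reasoning
    u′ = u ∘ punchIn k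
    X = dot u′ (x ∘ punchIn k)
    R = dot u′ (r ∘ punchIn k)

  Nonzero : ∀ {d} → (Fin d → Carrier) → Set
  Nonzero u = ∃ λ k → u k ≢ 0#

  Kills : ∀ {d} → (Fin d → Carrier) → List (Fin d → Carrier) → Set
  Kills u = All (λ r → dot u r ≡ 0#)

  kills-eliminate : ∀ {d} (k : Fin (suc d)) {r rows} u → Kills u (r ∷ rows) →
                    Kills (u ∘ punchIn k) (map (eliminate k r) rows)
  kills-eliminate k {r} {rows} u (u·r≡0 ∷ kills) = Allₚ.map⁺ (All.map
    (λ {x} u·x≡0 → trans (dot-eliminate k r x u u·r≡0) (trans (cong (r k *_) u·x≡0) (zeroʳ (r k)))) kills)

  -- Both alternatives are used: a nonzero solution gives a hyperplane or a direction of rotation, a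
  -- trivial kernel certifies a facet. The bound on `d` rules out triviality when there are fewer
  -- rows than unknowns.
  Kernel : ∀ d → List (Fin d → Carrier) → Set
  Kernel d rows =
    (∃ λ u → Nonzero u × Kills u rows) ⊎
    ((∀ u → Kills u rows → ∀ k → u k ≡ 0#) × d ℕ.≤ length rows)

  skip-zero-row : ∀ {d r rows} → ¬ Nonzero r → Kernel d rows → Kernel d (r ∷ rows)
  skip-zero-row {r = r} r≡0 (inj₁ (u , u≢0 , kills)) =
    inj₁ (u , u≢0 , trans (dot-comm u r) (dot-zero u λ k →
      decidable-stable (r k ≟ 0#) λ rk≢0 → r≡0 (k , rk≢0)) ∷ kills)
  skip-zero-row r≡0 (inj₂ (trivial , d≤)) = inj₂ ((λ { u (_ ∷ kills) → trivial u kills }) , m≤n⇒m≤1+n d≤)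

  pivot : ∀ {d} (k : Fin (suc d)) {r rows} → r k ≢ 0# →
          Kernel d (map (eliminate k r) rows) → Kernel (suc d) (r ∷ rows)
  pivot k {r} rk≢0 (inj₁ (u′ , (l , u′l≢0) , kills)) =
    inj₁ (u , (punchIn k l , ul≢0) , u·r≡0 ∷ All.map (λ {x} → u·x≡0 x) (Allₚ.map⁻ kills))
    where
    open ≡-Reasoning
    R = dot u′ (r ∘ punchIn k)
    -- Back-substitution: the only value at `k` for which the extended vector kills `r`.
    c = - (inv (r k) * R)
    u = insertAt u′ k c
    u′≗ : ∀ l → u (punchIn k l) ≡ u′ l
    u′≗ = insertAt-punchIn u′ k c
    ul≢0 : u (punchIn k l) ≢ 0#
    ul≢0 eq = u′l≢0 (trans (sym (u′≗ l)) eq)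
    u·r≡0 : dot u r ≡ 0#
    u·r≡0 = begin
      dot u r                                ≡⟨ dot-punchIn k u r ⟩
      u k * r k + dot (u ∘ punchIn k) (r ∘ punchIn k)
        ≡⟨ cong₂ _+_ (cong (_* r k) (insertAt-lookup u′ k c)) (dot-cong u′≗) ⟩
      c * r k + R
        ≡⟨ solve 3 (λ i R r → (:- (i :* R)) :* r :+ R := R :+ (:- ((r :* i) :* R))) refl (inv (r k)) R (r k) ⟩
      R + - (r k * inv (r k) * R)            ≡⟨ cong (λ z → R + - (z * R)) (inv-inverseʳ rk≢0) ⟩
      R + - (1# * R)                         ≡⟨ cong (λ z → R + - z) (*-identityˡ R) ⟩
      R + - R                                ≡⟨ -‿inverseʳ R ⟩
      0# ∎
    u·x≡0 : ∀ x → dot u′ (eliminate k r x) ≡ 0# → dot u x ≡ 0#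
    u·x≡0 x eq = x*y≡0⇒y≡0 rk≢0 (trans (sym (dot-eliminate k r x u u·r≡0)) (trans (dot-cong u′≗) eq))
  pivot k {r} {rows} rk≢0 (inj₂ (trivial , d≤)) =
    inj₂ (trivial′ , s≤s (subst (_ ℕ.≤_) (length-map (eliminate k r) rows) d≤))
    where
    open ≡-Reasoning
    trivial′ : ∀ u → Kills u (r ∷ rows) → ∀ l → u l ≡ 0#
    trivial′ u kills@(u·r≡0 ∷ _) l with k ≟ᶠ l
    ... | no k≢l = subst (λ l → u l ≡ 0#) (punchIn-punchOut k≢l)
                     (trivial (u ∘ punchIn k) (kills-eliminate k u kills) (punchOut k≢l))
    ... | yes refl = x*y≡0⇒y≡0 rk≢0 (begin
      r k * u k                  ≡⟨ *-comm (r k) (u k) ⟩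
      u k * r k                  ≡⟨ +-identityʳ _ ⟨
      u k * r k + 0#
        ≡⟨ cong (u k * r k +_) (dot-zero (r ∘ punchIn k) (trivial (u ∘ punchIn k) (kills-eliminate k u kills))) ⟨
      u k * r k + dot (u ∘ punchIn k) (r ∘ punchIn k)      ≡⟨ dot-punchIn k u r ⟨
      dot u r                    ≡⟨ u·r≡0 ⟩
      0# ∎)

  kernel : ∀ d rows → Kernel d rows
  kernel zero    rows = inj₂ ((λ _ _ ()) , z≤n)
  kernel (suc d) []   = inj₁ ((λ _ → 1#) , (zero , λ 1≡0 → 0≢1 (sym 1≡0)) , [])
  kernel (suc d) (r ∷ rows) =
    choose (any? λ k → ¬? (r k ≟ 0#)) (λ k → kernel d (map (eliminate k r) rows)) (kernel (suc d) rows)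
    where
    choose : Dec (Nonzero r) → (∀ k → Kernel d (map (eliminate k r) rows)) → Kernel (suc d) rows →
           Kernel (suc d) (r ∷ rows)
    choose (yes (k , rk≢0)) eliminated _    = pivot k rk≢0 (eliminated k)
    choose (no r≡0)         _          rest = skip-zero-row r≡0 rest

-- Turns faces, given by predicates, into finite subsets, whose strict inclusion is well-founded in
-- both directions: downwards for the descent to an edge, upwards for the ascent to a facet.
⊂-tabulate : ∀ {n} {P Q : Fin n → Set} (P? : Decidable P) (Q? : Decidable Q) →
             (∀ {i} → P i → Q i) → ∀ j → Q j → ¬ P j →
             tabulate (does ∘ P?) ⊂ tabulate (does ∘ Q?)
⊂-tabulate P? Q? P⊆Q j Qj ¬Pj =
  (λ i∈P → ∈⁺ Q? (P⊆Q (∈⁻ P? i∈P))) , j , ∈⁺ Q? Qj , ¬Pj ∘ ∈⁻ P?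
  where
  ∈⁺ : ∀ {n} {P : Fin n → Set} (P? : Decidable P) {i} → P i → i ∈ₛ tabulate (does ∘ P?)
  ∈⁺ P? {i} Pi = lookup⇒[]= i _ (trans (lookup∘tabulate (does ∘ P?) i) (dec-true (P? i) Pi))
  ∈⁻ : ∀ {n} {P : Fin n → Set} (P? : Decidable P) {i} → i ∈ₛ tabulate (does ∘ P?) → P i
  ∈⁻ P? {i} i∈P with P? i | trans (sym (lookup∘tabulate (does ∘ P?) i)) ([]=⇒lookup i∈P)
  ... | yes Pi | _ = Pi

-- Extrema over finitely many points

module Optimisation (F : OrderedField) where
  open OrderedField F
  open FieldProperties F
  open CommutativeRing commutativeRing using (*-comm; *-identityʳ; *-identityˡ; +-identityˡ; +-identityʳ; -‿inverseʳ)

  nonpos+nonpos : ∀ {x y} → x ≤ 0# → y ≤ 0# → x + y ≤ 0#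
  nonpos+nonpos (inj₁ x<0) y≤0 = inj₁ (neg+nonpos x<0 y≤0)
  nonpos+nonpos {y = y} (inj₂ refl) y≤0 =
    subst (_≤ 0#) (sym (+-identityˡ y)) y≤0

  x≤y⇒x-y≤0 : ∀ {x y} → x ≤ y → x + - y ≤ 0#
  x≤y⇒x-y≤0 (inj₁ x<y) = inj₁ (x<y⇒x-y<0 x<y)
  x≤y⇒x-y≤0 {x} (inj₂ refl) = inj₂ (-‿inverseʳ x)

  *-monoˡ-<-pos : ∀ {x y c} → 0# < c → x < y → x * c < y * c
  *-monoˡ-<-pos {x} {y} {c} 0<c x<y = x-y<0⇒x<y (subst (_< 0#)
    (solve 3 (λ x y c → c :* (x :+ :- y) := x :* c :+ :- (y :* c)) refl x y c)
    (pos*neg 0<c (x<y⇒x-y<0 x<y)))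

  *-monoˡ-≤-pos : ∀ {x y c} → 0# < c → x ≤ y → x * c ≤ y * c
  *-monoˡ-≤-pos 0<c (inj₁ x<y)  = inj₁ (*-monoˡ-<-pos 0<c x<y)
  *-monoˡ-≤-pos 0<c (inj₂ refl) = inj₂ refl

  0<⇒≢0 : ∀ {x} → 0# < x → x ≢ 0#
  0<⇒≢0 0<x x≡0 = <⇒≢ 0<x (sym x≡0)

  ratio-clear : ∀ x {b} → b ≢ 0# → ∀ c → x * inv b * (b * c) ≡ x * c
  ratio-clear x {b} b≢0 c = begin
    x * inv b * (b * c)     ≡⟨ solve 4 (λ x i b c → x :* i :* (b :* c) := x :* ((b :* i) :* c)) refl x (inv b) b c ⟩
    x * (b * inv b * c)     ≡⟨ cong (λ z → x * (z * c)) (inv-inverseʳ b≢0) ⟩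
    x * (1# * c)            ≡⟨ cong (x *_) (*-identityˡ c) ⟩
    x * c                   ∎
    where open ≡-Reasoning

  cross-≤ : ∀ {x b y d} → 0# < b → 0# < d → x * inv b ≤ y * inv d → x * d ≤ y * b
  cross-≤ {x} {b} {y} {d} 0<b 0<d le = subst₂ _≤_
    (ratio-clear x (0<⇒≢0 0<b) d)
    (trans (cong (y * inv d *_) (*-comm b d)) (ratio-clear y (0<⇒≢0 0<d) b))
    (*-monoˡ-≤-pos (*-pos 0<b 0<d) le)

  uncross-< : ∀ {x b y d} → 0# < b → 0# < d → x * d < y * b → x * inv b < y * inv d
  uncross-< {x} {b} {y} {d} 0<b 0<d lt with (x * inv b) <? (y * inv d)
  ... | yes p = p
  ... | no ¬p = contradiction (cross-≤ {y} {d} {x} {b} 0<d 0<b (≮⇒≥ ¬p)) (<⇒≱ lt)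

  open Extrema totalOrder using (argmax; argmax-all; f[xs]≤f[argmax]; max; xs≤max)

  -- Rotating the hyperplane {f = 0} towards {g = 0} until it first touches a point where g is positive.
  opaque
    rotate : ∀ {n} (f g : Fin n → Carrier) → (∀ i → f i ≤ 0#) → (∀ i → 0# < g i → f i < 0#) →
             ∀ j → 0# < g j →
             ∃₂ λ α β → 0# < α × 0# < β × (∀ i → α * f i + β * g i ≤ 0#) ×
               ∃ λ i → 0# < g i × α * f i + β * g i ≡ 0#
    rotate {n} f g f≤0 g>0⇒f<0 j 0<gj =
      -- `m` maximises `f / g` among the points with `g` positive. With these weights the
      -- combination vanishes at `m`, and maximality, after clearing denominators, makes it
      -- nonpositive at the other such points.
      g m , - f m , 0<gm , neg-pos (g>0⇒f<0 m 0<gm) , valid , m , 0<gm ,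
      trans (eq (g m) (f m) (f m) (g m)) (-‿inverseʳ (f m * g m))
      where
      0<g? : ∀ i → Dec (0# < g i)
      0<g? i = 0# <? g i
      candidates : List (Fin n)
      candidates = filter 0<g? (allFin n)
      ratio : Fin n → Carrier
      ratio i = f i * inv (g i)
      m : Fin n
      m = argmax ratio j candidates
      0<gm : 0# < g m
      0<gm = argmax-all ratio 0<gj (Allₚ.all-filter 0<g? (allFin n))
      eq : ∀ α f φ g → α * f + (- φ) * g ≡ f * α + - (φ * g)
      eq = solve 4 (λ α f φ g → α :* f :+ (:- φ) :* g := f :* α :+ :- (φ :* g)) refl
      valid : ∀ i → g m * f i + (- f m) * g i ≤ 0#
      valid i with 0<g? i
      ... | no ¬0<gi = nonpos+nonpos
        (nonneg*nonpos (inj₁ 0<gm) (f≤0 i))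
        (nonneg*nonpos (inj₁ (neg-pos (g>0⇒f<0 m 0<gm))) (≮⇒≥ ¬0<gi))
      ... | yes 0<gi = subst (_≤ 0#) (sym (eq (g m) (f i) (f m) (g i))) (x≤y⇒x-y≤0 (cross-≤ 0<gi 0<gm
              (All.lookup (f[xs]≤f[argmax] j candidates) (∈-filter⁺ 0<g? (∈-allFin i) 0<gi))))

  opaque
    -- It suffices that `N` exceeds every ratio of `g i` to `- h i`. If `h` supports a face, adding
    -- `N` times `h` leaves `g` unchanged on that face and makes it negative elsewhere.
    dominate : ∀ {n} (h g : Fin n → Carrier) → ∃ λ N → ∀ i → h i < 0# → g i + N * h i < 0#
    dominate {n} h g = N , bound
      where
      ratio : Fin n → Carrier
      ratio i = g i * inv (- h i)
      N : Carrier
      -- Indices with `h i` nonnegative also enter the maximum; they can only raise `N`. The summand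
      -- 1 makes the bound strict.
      N = max 0# (map ratio (allFin n)) + 1#
      ratio<N : ∀ i → ratio i < N
      ratio<N i = ≤-<-trans (All.lookup (xs≤max 0# (map ratio (allFin n))) (∈-map⁺ ratio (∈-allFin i)))
        (subst (_< N) (+-identityʳ _) (+-monoʳ-< _ 0<1))
      bound : ∀ i → h i < 0# → g i + N * h i < 0#
      bound i hi<0 = subst (_< 0#)
        (trans (cong (_+ - (N * - h i)) ratio-eq)
          (solve 3 (λ g N h → g :+ :- (N :* :- h) := g :+ N :* h) refl (g i) N (h i)))
        (x<y⇒x-y<0 (*-monoˡ-<-pos 0<-hi (ratio<N i)))
        where
        0<-hi : 0# < - h i
        0<-hi = neg-pos hi<0
        ratio-eq : ratio i * - h i ≡ g i
        ratio-eq = trans (cong (ratio i *_) (sym (*-identityʳ (- h i))))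
          (trans (ratio-clear (g i) (0<⇒≢0 0<-hi) 1#) (*-identityʳ (g i)))

-- Affine functionals and faces

module Polytope (F : OrderedField) {n : ℕ} (p : Fin n → Geometry.Point F)
                (vertices : Geometry.AreVertices F p) (fullDim : Geometry.FullDim F p) where
  open OrderedField F
  open Geometry F
  open FieldProperties F
  open LinearAlgebra F
  open Optimisation F
  open CommutativeRing commutativeRing
    using (+-identityˡ; +-identityʳ; zeroʳ; +-comm; *-identityˡ; *-identityʳ; -‿inverseʳ)

  -- The affine function x ↦ u₀ + u₁ x₁ + … + u₄ x₄ on the vertices.
  Functional : Set
  Functional = Fin 5 → Carrier

  homogenise : Fin n → Functional
  homogenise i zero    = 1#
  homogenise i (suc k) = p i k

  opaque
    ⟦_⟧ : Functional → Fin n → Carrier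
    ⟦ u ⟧ i = dot u (homogenise i)

    ⟦⟧-dot : ∀ u i → ⟦ u ⟧ i ≡ dot u (homogenise i)
    ⟦⟧-dot u i = refl

  ⟦⟧-affine : ∀ u i → ⟦ u ⟧ i ≡ u zero + dot (u ∘ suc) (p i)
  ⟦⟧-affine u i = trans (⟦⟧-dot u i) (cong (_+ dot (u ∘ suc) (p i)) (*-identityʳ (u zero)))

  Valid : Functional → Set
  Valid u = ∀ i → ⟦ u ⟧ i ≤ 0#

  Tight : Functional → Fin n → Set
  Tight u i = ⟦ u ⟧ i ≡ 0#

  tight? : ∀ u → Decidable (Tight u)
  tight? u i = ⟦ u ⟧ i ≟ 0#

  valid∧¬tight⇒<0 : ∀ {u i} → Valid u → ¬ Tight u i → ⟦ u ⟧ i < 0#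
  valid∧¬tight⇒<0 {i = i} valid = ≤∧≢⇒< (valid i)

  ⟦comb⟧ : ∀ α u β w i → ⟦ comb α u β w ⟧ i ≡ α * ⟦ u ⟧ i + β * ⟦ w ⟧ i
  ⟦comb⟧ α u β w i = trans (⟦⟧-dot (comb α u β w) i) (trans (dot-comb α u β w (homogenise i))
    (sym (cong₂ (λ s t → α * s + β * t) (⟦⟧-dot u i) (⟦⟧-dot w i))))

  dot-negate : ∀ {d} (u x : Fin d → Carrier) → dot (λ k → - u k) x ≡ - dot u x
  dot-negate {zero}  u x = sym -0#≈0#
  dot-negate {suc d} u x = trans (cong ((- u zero) * x zero +_) (dot-negate (u ∘ suc) (x ∘ suc)))
    (solve 3 (λ a x s → (:- a) :* x :+ :- s := :- (a :* x :+ s)) refl (u zero) (x zero) (dot (u ∘ suc) (x ∘ suc)))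

  negate : Functional → Functional
  negate u k = - u k

  ⟦negate⟧ : ∀ u i → ⟦ negate u ⟧ i ≡ - ⟦ u ⟧ i
  ⟦negate⟧ u i = trans (⟦⟧-dot (negate u) i) (trans (dot-negate u (homogenise i)) (cong -_ (sym (⟦⟧-dot u i))))

  translate : Carrier → Functional → Functional
  translate c u zero    = u zero + c
  translate c u (suc k) = u (suc k)

  ⟦translate⟧ : ∀ c u i → ⟦ translate c u ⟧ i ≡ ⟦ u ⟧ i + c
  ⟦translate⟧ c u i = trans (⟦⟧-affine (translate c u) i) (trans
    (solve 3 (λ a c s → (a :+ c) :+ s := (a :+ s) :+ c) refl (u zero) c (dot (u ∘ suc) (p i)))
    (cong (_+ c) (sym (⟦⟧-affine u i))))

  toFace : ∀ {S : Fin n → Set} u → Valid u → (∀ i → S i ⇔ Tight u i) → IsFace p S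
  toFace u valid S⇔ = u ∘ suc , - u zero , below , λ i → mk⇔
    (λ Si → x-y≡0⇒x≡y (trans (sym (shift i)) (Equivalence.to (S⇔ i) Si)))
    (λ eq → Equivalence.from (S⇔ i) (trans (shift i) (trans (cong (_+ - - u zero) eq) (-‿inverseʳ _))))
    where
    shift : ∀ i → ⟦ u ⟧ i ≡ dot (u ∘ suc) (p i) + - (- u zero)
    shift i = trans (⟦⟧-affine u i)
      (solve 2 (λ a s → a :+ s := s :+ :- (:- a)) refl (u zero) (dot (u ∘ suc) (p i)))
    below : ∀ i → dot (u ∘ suc) (p i) ≤ - u zero
    below i with valid i
    ... | inj₁ lt = inj₁ (x-y<0⇒x<y (subst (_< 0#) (shift i) lt))
    ... | inj₂ eq = inj₂ (x-y≡0⇒x≡y (trans (sym (shift i)) eq))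

  fromFace : ∀ {S : Fin n → Set} → IsFace p S → ∃ λ u → Valid u × (∀ i → S i ⇔ Tight u i)
  fromFace (a , b , below , S⇔) = u , valid , λ i → mk⇔
    (λ Si → trans (shift i) (trans (cong (_+ - b) (Equivalence.to (S⇔ i) Si)) (-‿inverseʳ b)))
    (λ eq → Equivalence.from (S⇔ i) (x-y≡0⇒x≡y (trans (sym (shift i)) eq)))
    where
    u : Functional
    u zero    = - b
    u (suc k) = a k
    shift : ∀ i → ⟦ u ⟧ i ≡ dot a (p i) + - b
    shift i = trans (⟦⟧-affine u i) (+-comm (- b) (dot a (p i)))
    valid : Valid u
    valid i with below i
    ... | inj₁ lt = inj₁ (subst (_< 0#) (sym (shift i)) (x<y⇒x-y<0 lt))
    ... | inj₂ eq = inj₂ (trans (shift i) (trans (cong (_+ - b) eq) (-‿inverseʳ b)))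

  -- Full dimension forces the linear part of a functional vanishing at all vertices to be zero; the
  -- vertex `o` then forces the constant term to be zero as well.
  nonzero⇒¬tight : ∀ u → Fin n → Nonzero u → ∃ λ i → ¬ Tight u i
  nonzero⇒¬tight u o (k , uk≢0) with any? (¬? ∘ tight? u)
  ... | yes found = found
  ... | no none = contradiction (u≡0 k) uk≢0
    where
    tight : ∀ i → u zero + dot (u ∘ suc) (p i) ≡ 0#
    tight i = trans (sym (⟦⟧-affine u i)) (decidable-stable (tight? u i) (λ ¬t → none (i , ¬t)))
    linear≡0 : ∀ k → u (suc k) ≡ 0#
    linear≡0 = fullDim (u ∘ suc) (- u zero) λ i → x-y≡0⇒x≡y (trans
      (solve 2 (λ a s → s :+ :- (:- a) := a :+ s) refl (u zero) (dot (u ∘ suc) (p i))) (tight i))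
    u≡0 : ∀ k → u k ≡ 0#
    u≡0 (suc k) = linear≡0 k
    u≡0 zero = trans (sym (+-identityʳ (u zero))) (trans
      (cong (u zero +_) (sym (dot-zero (p o) linear≡0))) (tight o))

  record Exposes (e : Functional) (v : Fin n) : Set where
    field
      valid : Valid e
      tight : Tight e v
      only  : ∀ {i} → Tight e i → i ≡ v

    elsewhere : ∀ {i} → i ≢ v → ⟦ e ⟧ i < 0#
    elsewhere i≢v = valid∧¬tight⇒<0 valid (i≢v ∘ only)

  opaque
    expose : ∀ v → ∃ λ e → Exposes e v
    expose v with fromFace (vertices v)
    ... | e , valid , tight⇔ = e , record
      { valid = valid ; tight = Equivalence.to (tight⇔ v) refl ; only = Equivalence.from (tight⇔ _) }

  record Rotation (f g : Functional) : Set where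
    field
      α β   : Carrier
      0<α   : 0# < α
      0<β   : 0# < β
      valid : Valid (comb α f β g)
      touch : ∃ λ i → 0# < ⟦ g ⟧ i × Tight (comb α f β g) i

    rotated : Functional
    rotated = comb α f β g

    balance : ∀ {i} → Tight rotated i → α * ⟦ f ⟧ i + β * ⟦ g ⟧ i ≡ 0#
    balance {i} tight = trans (sym (⟦comb⟧ α f β g i)) tight

    tight-both : ∀ {i} → Tight f i → Tight g i → Tight rotated i
    tight-both {i} f≡0 g≡0 = trans (⟦comb⟧ α f β g i) (trans
      (cong₂ _+_ (trans (cong (α *_) f≡0) (zeroʳ α)) (trans (cong (β *_) g≡0) (zeroʳ β))) (+-identityˡ 0#))

    -- On the rotated face the two weighted terms cancel. If `f` exposes a vertex, every other
    -- vertex of the rotated face therefore has `g` positive.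
    tight⇒pos : ∀ {i} → ⟦ f ⟧ i < 0# → Tight rotated i → 0# < ⟦ g ⟧ i
    tight⇒pos {i} fi<0 tight = pos*-cancel-pos 0<β (subst (0# <_) (sym βg≡-αf) (neg-pos (pos*neg 0<α fi<0)))
      where
      βg≡-αf : β * ⟦ g ⟧ i ≡ - (α * ⟦ f ⟧ i)
      βg≡-αf = x-y≡0⇒x≡y (trans
        (solve 2 (λ a b → b :+ :- (:- a) := a :+ b) refl (α * ⟦ f ⟧ i) (β * ⟦ g ⟧ i)) (balance tight))

  opaque
    rotateTowards : ∀ f g → Valid f → (∀ i → 0# < ⟦ g ⟧ i → ⟦ f ⟧ i < 0#) → ∀ j → 0# < ⟦ g ⟧ j → Rotation f g
    rotateTowards f g valid pos⇒neg j 0<gj = fromRotate (rotate ⟦ f ⟧ ⟦ g ⟧ valid pos⇒neg j 0<gj)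
      where
      fromRotate : (∃₂ λ α β → 0# < α × 0# < β × (∀ i → α * ⟦ f ⟧ i + β * ⟦ g ⟧ i ≤ 0#) ×
                     ∃ λ i → 0# < ⟦ g ⟧ i × α * ⟦ f ⟧ i + β * ⟦ g ⟧ i ≡ 0#) → Rotation f g
      fromRotate (α , β , 0<α , 0<β , valid′ , i , 0<gi , tight) = record
        { α = α ; β = β ; 0<α = 0<α ; 0<β = 0<β
        ; valid = λ i → subst (_≤ 0#) (sym (⟦comb⟧ α f β g i)) (valid′ i)
        ; touch = i , 0<gi , trans (⟦comb⟧ α f β g i) tight
        }

  -- Edges inside faces and the simplex step

  Edge : Fin n → Fin n → Set
  Edge = Adj p

  tightSet : Functional → Subset n
  tightSet u = tabulate (does ∘ tight? u)

  record FaceAt (v : Fin n) (h : Functional) : Set where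
    field
      valid : Valid h
      tight : Tight h v
      other : ∃ λ i → i ≢ v × Tight h i

  Smaller : Fin n → Functional → Set
  Smaller v h = ∃ λ h′ → FaceAt v h′ × (∀ {i} → Tight h′ i → Tight h i) × (∃ λ j → Tight h j × ¬ Tight h′ j)

  -- If w₁ ≢ w₂ lie on a face with v, rotating the hyperplane exposing v towards the functional
  -- exposing w₁ in that face cuts out a smaller face: it cannot touch w₁ and w₂ at once, because
  -- f is at least as close to 0 at w₁ as at w₂, and e is maximal only at w₁.
  module Shrink {v w₁ w₂ h f e} (face : FaceAt v h) (exf : Exposes f v) (exe : Exposes e w₁)
                (hw₁ : Tight h w₁) (hw₂ : Tight h w₂) (w₁≢v : w₁ ≢ v) (w₂≢w₁ : w₂ ≢ w₁)
                (f₂≤f₁ : ⟦ f ⟧ w₂ ≤ ⟦ f ⟧ w₁)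
                (N : Carrier)
                (dominated : ∀ i → ⟦ h ⟧ i < 0# → ⟦ translate (- ⟦ e ⟧ v) e ⟧ i + N * ⟦ h ⟧ i < 0#) where
    module H = FaceAt face

    g c : Functional
    g = translate (- ⟦ e ⟧ v) e
    -- On the face of `h` this is `e` shifted to vanish at `v`; off the face it is negative. Being
    -- positive only on the face, it keeps the rotated face inside it.
    c = comb 1# g N h

    ⟦c⟧ : ∀ i → ⟦ c ⟧ i ≡ ⟦ g ⟧ i + N * ⟦ h ⟧ i
    ⟦c⟧ i = trans (⟦comb⟧ 1# g N h i) (cong (_+ N * ⟦ h ⟧ i) (*-identityˡ (⟦ g ⟧ i)))

    ⟦c⟧-on-h : ∀ {i} → Tight h i → ⟦ c ⟧ i ≡ ⟦ e ⟧ i + - ⟦ e ⟧ v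
    ⟦c⟧-on-h {i} hi = trans (⟦c⟧ i) (trans
      (cong₂ _+_ (⟦translate⟧ (- ⟦ e ⟧ v) e i) (trans (cong (N *_) hi) (zeroʳ N))) (+-identityʳ _))

    cv≡0 : Tight c v
    cv≡0 = trans (⟦c⟧-on-h H.tight) (-‿inverseʳ _)

    pos⇒≢v : ∀ {i} → 0# < ⟦ c ⟧ i → i ≢ v
    pos⇒≢v 0<ci refl = 0<⇒≢0 0<ci cv≡0

    pos⇒h : ∀ {i} → 0# < ⟦ c ⟧ i → Tight h i
    pos⇒h {i} 0<ci = [ (λ hi<0 → contradiction
      (<-trans 0<ci (subst (_< 0#) (sym (⟦c⟧ i)) (dominated i hi<0))) <-irrefl) , (λ hi≡0 → hi≡0) ] (H.valid i)

    0<cw₁ : 0# < ⟦ c ⟧ w₁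
    0<cw₁ = subst (0# <_)
      (sym (trans (⟦c⟧-on-h hw₁) (trans (cong (_+ - ⟦ e ⟧ v) (Exposes.tight exe)) (+-identityˡ _))))
      (neg-pos (Exposes.elsewhere exe (w₁≢v ∘ sym)))

    cut : Rotation f c → Smaller v h
    cut R = R.rotated , record
        { valid = R.valid
        ; tight = R.tight-both (Exposes.tight exf) cv≡0
        ; other = case-touch R.touch }
      , R⊆h , missed
      where
      module R = Rotation R
      case-touch : (∃ λ i → 0# < ⟦ c ⟧ i × Tight R.rotated i) → ∃ λ i → i ≢ v × Tight R.rotated i
      case-touch (i , 0<ci , tight) = i , pos⇒≢v 0<ci , tight
      R⊆h : ∀ {i} → Tight R.rotated i → Tight h i
      R⊆h {i} tight with i ≟ᶠ v
      ... | yes refl = H.tight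
      ... | no i≢v   = pos⇒h (R.tight⇒pos (Exposes.elsewhere exf i≢v) tight)
      not-both : Tight R.rotated w₁ → ¬ Tight R.rotated w₂
      not-both t₁ t₂ = <⇒≢ (x-y<0⇒x<y (subst (_< 0#) (sym difference) (neg+nonpos e-part f-part)))
                           (trans (R.balance t₂) (sym (R.balance t₁)))
        where
        e-part : R.β * (⟦ e ⟧ w₂ + - ⟦ e ⟧ w₁) < 0#
        e-part = pos*neg R.0<β (x<y⇒x-y<0
          (subst (⟦ e ⟧ w₂ <_) (sym (Exposes.tight exe)) (Exposes.elsewhere exe w₂≢w₁)))
        f-part : R.α * (⟦ f ⟧ w₂ + - ⟦ f ⟧ w₁) ≤ 0#
        f-part = nonneg*nonpos (inj₁ R.0<α) (x≤y⇒x-y≤0 f₂≤f₁)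
        difference : (R.α * ⟦ f ⟧ w₂ + R.β * ⟦ c ⟧ w₂) + - (R.α * ⟦ f ⟧ w₁ + R.β * ⟦ c ⟧ w₁) ≡
                     R.β * (⟦ e ⟧ w₂ + - ⟦ e ⟧ w₁) + R.α * (⟦ f ⟧ w₂ + - ⟦ f ⟧ w₁)
        difference = trans
          (cong₂ (λ s t → (R.α * ⟦ f ⟧ w₂ + R.β * s) + - (R.α * ⟦ f ⟧ w₁ + R.β * t)) (⟦c⟧-on-h hw₂) (⟦c⟧-on-h hw₁))
          (solve 7 (λ α β f₁ f₂ e₁ e₂ z → (α :* f₂ :+ β :* (e₂ :+ :- z)) :+ :- (α :* f₁ :+ β :* (e₁ :+ :- z))
                                     := β :* (e₂ :+ :- e₁) :+ α :* (f₂ :+ :- f₁)) refl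
            R.α R.β (⟦ f ⟧ w₁) (⟦ f ⟧ w₂) (⟦ e ⟧ w₁) (⟦ e ⟧ w₂) (⟦ e ⟧ v))
      missed : ∃ λ j → Tight h j × ¬ Tight R.rotated j
      missed with tight? R.rotated w₁
      ... | no ¬t₁ = w₁ , hw₁ , ¬t₁
      ... | yes t₁ = w₂ , hw₂ , not-both t₁

    smaller : Smaller v h
    smaller = cut (rotateTowards f c (Exposes.valid exf)
      (λ i 0<ci → Exposes.elsewhere exf (pos⇒≢v 0<ci)) w₁ 0<cw₁)

  opaque
    shrink : ∀ {v w₁ w₂ h f e} → FaceAt v h → Exposes f v → Exposes e w₁ →
             Tight h w₁ → Tight h w₂ → w₁ ≢ v → w₂ ≢ w₁ → ⟦ f ⟧ w₂ ≤ ⟦ f ⟧ w₁ → Smaller v h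
    shrink {v} {h = h} {e = e} face exf exe hw₁ hw₂ w₁≢v w₂≢w₁ f₂≤f₁ =
      Shrink.smaller face exf exe hw₁ hw₂ w₁≢v w₂≢w₁ f₂≤f₁
        (proj₁ (dominate ⟦ h ⟧ ⟦ translate (- ⟦ e ⟧ v) e ⟧))
        (proj₂ (dominate ⟦ h ⟧ ⟦ translate (- ⟦ e ⟧ v) e ⟧))

  opaque
    -- While the face has two vertices besides `v`, `shrink` applies, the one at which the
    -- functional exposing `v` is larger playing `w₁`. A face with a single vertex besides `v` is an
    -- edge.
    edgeInFace : ∀ {v h} → FaceAt v h → ∃ λ k → Tight h k × Edge v k
    edgeInFace face = go face (⊂-wellFounded _)
      where
      go : ∀ {v h} → FaceAt v h → Acc _⊂_ (tightSet h) → ∃ λ k → Tight h k × Edge v k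
      go {v} {h} face (acc rec) = choose (FaceAt.other face) (expose v)
        where
        EdgeInFace : Set
        EdgeInFace = ∃ λ k → Tight h k × Edge v k
        descend : Smaller v h → EdgeInFace
        descend (h′ , face′ , h′⊆h , j , hj , ¬h′j) =
          let k , h′k , edge = go face′ (rec (⊂-tabulate (tight? h′) (tight? h) h′⊆h j hj ¬h′j))
          in k , h′⊆h h′k , edge
        compare-others : ∀ {f i w} → Exposes f v → i ≢ v → Tight h i → w ≢ v → w ≢ i → Tight h w →
                         Dec (⟦ f ⟧ w ≤ ⟦ f ⟧ i) → EdgeInFace
        compare-others {i = i} exf i≢v hi w≢v w≢i hw (yes le) =
          descend (shrink face exf (proj₂ (expose i)) hi hw i≢v w≢i le)
        compare-others {w = w} exf i≢v hi w≢v w≢i hw (no ¬le) =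
          descend (shrink face exf (proj₂ (expose w)) hw hi w≢v (w≢i ∘ sym) (≮⇒≥ (¬le ∘ inj₁)))
        choose : (∃ λ i → i ≢ v × Tight h i) → (∃ λ f → Exposes f v) → EdgeInFace
        choose (i , i≢v , hi) (f , exf) with any? (λ w → ¬? (w ≟ᶠ v) ×-dec ¬? (w ≟ᶠ i) ×-dec tight? h w)
        ... | yes (w , w≢v , w≢i , hw) = compare-others exf i≢v hi w≢v w≢i hw (⟦ f ⟧ w ≤? ⟦ f ⟧ i)
        ... | no none = i , hi , i≢v ∘ sym , toFace h (FaceAt.valid face) λ k → mk⇔
          [ (λ { refl → FaceAt.tight face }) , (λ { refl → hi }) ] (only k)
          where
          only : ∀ k → Tight h k → k ≡ v ⊎ k ≡ i
          only k hk with k ≟ᶠ v | k ≟ᶠ i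
          ... | yes k≡v | _       = inj₁ k≡v
          ... | no _    | yes k≡i = inj₂ k≡i
          ... | no k≢v  | no k≢i  = contradiction (k , k≢v , k≢i , hk) none

  opaque
    -- Rotating a hyperplane that exposes `v` towards `c` gives a face through `v` on which `c` is
    -- positive at all other vertices, so any edge of this face at `v` will do.
    improve : ∀ {v} c → Tight c v → ∀ j → 0# < ⟦ c ⟧ j → ∃ λ k → 0# < ⟦ c ⟧ k × Edge v k
    improve {v} c cv j 0<cj = ascend (edgeInFace record
      { valid = R.valid
      ; tight = R.tight-both (Exposes.tight ex) cv
      ; other = proj₁ R.touch , pos⇒≢v (proj₁ (proj₂ R.touch)) , proj₂ (proj₂ R.touch)
      })
      where
      ex : Exposes (proj₁ (expose v)) v
      ex = proj₂ (expose v)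
      pos⇒≢v : ∀ {i} → 0# < ⟦ c ⟧ i → i ≢ v
      pos⇒≢v 0<ci refl = 0<⇒≢0 0<ci cv
      module R = Rotation (rotateTowards (proj₁ (expose v)) c (Exposes.valid ex)
        (λ i 0<ci → Exposes.elsewhere ex (pos⇒≢v 0<ci)) j 0<cj)
      ascend : (∃ λ k → Tight R.rotated k × Edge v k) → ∃ λ k → 0# < ⟦ c ⟧ k × Edge v k
      ascend (k , tight , edge@(v≢k , _)) =
        k , R.tight⇒pos (Exposes.elsewhere ex (v≢k ∘ sym)) tight , edge

-- Walks, paths and linkages

module Walks {n : ℕ} {E : Fin n → Fin n → Set} where
  open DecMembership {A = Fin n} _≟ᶠ_ using (_∈?_)

  WalkIn : (Fin n → Set) → Fin n → Fin n → Set
  WalkIn Q s t = Σ (Walk E s t) λ w → All Q (verts w)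

  snoc : ∀ {Q u v w} → WalkIn Q u v → E v w → Q w → WalkIn Q u w
  snoc (stop v , q ∷ [])     e qw = step v e (stop _) , q ∷ qw ∷ []
  snoc (step u e′ w , q ∷ qs) e qw with snoc (w , qs) e qw
  ... | w′ , qs′ = step u e′ w′ , q ∷ qs′

  suffix : ∀ {s t u} (w : Walk E s t) → Unique (verts w) → u ∈ verts w →
           Σ (Walk E u t) λ w′ → Unique (verts w′) × (∀ {i} → i ∈ verts w′ → i ∈ verts w)
  suffix w@(stop _)       unique        (here refl)  = w , unique , (λ i∈ → i∈)
  suffix w@(step _ _ _)   unique        (here refl)  = w , unique , (λ i∈ → i∈)
  suffix (step _ _ w)     (_ ∷ unique)  (there u∈w) with suffix w unique u∈w
  ... | w′ , unique′ , w′⊆w = w′ , unique′ , there ∘ w′⊆w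

  toPath : ∀ {s t} (w : Walk E s t) →
           Σ (Path E s t) λ L → ∀ {i} → i ∈ verts (proj₁ L) → i ∈ verts w
  toPath w@(stop v) = (w , [] ∷ []) , (λ i∈ → i∈)
  toPath (step u e w) with toPath w
  ... | (w′ , unique) , w′⊆w with u ∈? verts w′
  ...   | no u∉w′ = (step u e w′ , Allₚ.¬Any⇒All¬ (verts w′) u∉w′ ∷ unique) ,
                    λ { (here refl) → here refl ; (there i∈) → there (w′⊆w i∈) }
  ...   | yes u∈w′ with suffix w′ unique u∈w′
  ...     | w″ , unique″ , w″⊆w′ = (w″ , unique″) , there ∘ w′⊆w ∘ w″⊆w′

  Linked : (x s₁ t₁ s₂ t₂ : Fin n) → Set
  Linked x s₁ t₁ s₂ t₂ =
    Σ (Path E s₁ t₁) λ L₁ → Σ (Path E s₂ t₂) λ L₂ →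
      Disjoint (verts (proj₁ L₁)) (verts (proj₁ L₂)) × x ∉ verts (proj₁ L₁) × x ∉ verts (proj₁ L₂)

  -- Loop erasure only drops vertices, so disjointness can be checked on the regions that confine
  -- the walks, without knowing the walks.
  link : ∀ {Q₁ Q₂ : Fin n → Set} {x s₁ t₁ s₂ t₂} → WalkIn Q₁ s₁ t₁ → WalkIn Q₂ s₂ t₂ →
         (∀ {i} → Q₁ i → ¬ Q₂ i) → ¬ Q₁ x → ¬ Q₂ x → Linked x s₁ t₁ s₂ t₂
  link (w₁ , q₁) (w₂ , q₂) disjoint ¬q₁x ¬q₂x with toPath w₁ | toPath w₂
  ... | L₁ , L₁⊆w₁ | L₂ , L₂⊆w₂ = L₁ , L₂ ,
    (λ i∈L₁ i∈L₂ → disjoint (All.lookup q₁ (L₁⊆w₁ i∈L₁)) (All.lookup q₂ (L₂⊆w₂ i∈L₂))) ,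
    (λ x∈L₁ → ¬q₁x (All.lookup q₁ (L₁⊆w₁ x∈L₁))) ,
    (λ x∈L₂ → ¬q₂x (All.lookup q₂ (L₂⊆w₂ x∈L₂)))

  swapPairs : ∀ {x s₁ t₁ s₂ t₂} → Linked x s₂ t₂ s₁ t₁ → Linked x s₁ t₁ s₂ t₂
  swapPairs (L₂ , L₁ , disjoint , x∉L₂ , x∉L₁) = L₁ , L₂ , (λ ∈L₁ ∈L₂ → disjoint ∈L₂ ∈L₁) , x∉L₁ , x∉L₂

  record Apart (x s₁ t₁ s₂ t₂ : Fin n) : Set where
    field
      x≢s₁  : x ≢ s₁
      x≢t₁  : x ≢ t₁
      x≢s₂  : x ≢ s₂
      x≢t₂  : x ≢ t₂
      s₁≢t₁ : s₁ ≢ t₁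
      s₁≢s₂ : s₁ ≢ s₂
      s₁≢t₂ : s₁ ≢ t₂
      t₁≢s₂ : t₁ ≢ s₂
      t₁≢t₂ : t₁ ≢ t₂
      s₂≢t₂ : s₂ ≢ t₂

  swapApart : ∀ {x s₁ t₁ s₂ t₂} → Apart x s₁ t₁ s₂ t₂ → Apart x s₂ t₂ s₁ t₁
  swapApart a = record
    { x≢s₁ = x≢s₂ ; x≢t₁ = x≢t₂ ; x≢s₂ = x≢s₁ ; x≢t₂ = x≢t₁ ; s₁≢t₁ = s₂≢t₂
    ; s₁≢s₂ = s₁≢s₂ ∘ sym ; s₁≢t₂ = t₁≢s₂ ∘ sym ; t₁≢s₂ = s₁≢t₂ ∘ sym ; t₁≢t₂ = t₁≢t₂ ∘ sym ; s₂≢t₂ = s₁≢t₁ }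
    where open Apart a

-- Connectivity of open half-spaces

module Connectivity (F : OrderedField) {n : ℕ} (p : Fin n → Geometry.Point F)
                    (vertices : Geometry.AreVertices F p) (fullDim : Geometry.FullDim F p) where
  open OrderedField F
  open Geometry F
  open FieldProperties F
  open LinearAlgebra F
  open Optimisation F
  open Polytope F p vertices fullDim
  open Walks {E = Edge}
  open CommutativeRing commutativeRing
    using (+-identityˡ; +-identityʳ; zeroˡ; zeroʳ; *-identityʳ; -‿inverseʳ)

  Edge-sym : ∀ {i j} → Edge i j → Edge j i
  Edge-sym (i≢j , a , b , below , S⇔) = i≢j ∘ sym , a , b , below , λ k → mk⇔
    (Equivalence.to (S⇔ k) ∘ swap) (swap ∘ Equivalence.from (S⇔ k))

  -- Climbing along e / φ, where e exposes v; the functional used at u is φ(u) e − e(u) φ,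
  -- which vanishes at u and is positive only where φ is positive and that ratio is larger than at u.
  opaque
    climb : ∀ φ u v → 0# < ⟦ φ ⟧ u → 0# < ⟦ φ ⟧ v → WalkIn (λ i → 0# < ⟦ φ ⟧ i) u v
    climb φ u₀ v 0<φu₀ 0<φv = go u₀ 0<φu₀ (spo-noetherian isSPO u₀)
      where
      e : Functional
      e = proj₁ (expose v)
      module E = Exposes (proj₂ (expose v))
      height : Fin n → Carrier
      height i = ⟦ e ⟧ i * inv (⟦ φ ⟧ i)
      isSPO : IsStrictPartialOrder (λ i j → height i ≡ height j) (λ i j → height i < height j)
      isSPO = On.isStrictPartialOrder height (IsStrictTotalOrder.isStrictPartialOrder isStrictTotalOrder)
      go : ∀ u → 0# < ⟦ φ ⟧ u → Acc (λ i j → height j < height i) u → WalkIn (λ i → 0# < ⟦ φ ⟧ i) u v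
      go u 0<φu (acc rec) = decide (u ≟ᶠ v)
        where
        c : Functional
        c = comb (⟦ φ ⟧ u) e (- ⟦ e ⟧ u) φ
        continue : u ≢ v → (∃ λ k → 0# < ⟦ c ⟧ k × Edge u k) → WalkIn (λ i → 0# < ⟦ φ ⟧ i) u v
        continue u≢v (k , 0<ck , edge) =
          let w , qs = go k 0<φk (rec (uncross-< 0<φu 0<φk higher)) in step u edge w , 0<φu ∷ qs
          where
          0<sum : 0# < ⟦ φ ⟧ u * ⟦ e ⟧ k + - ⟦ e ⟧ u * ⟦ φ ⟧ k
          0<sum = subst (0# <_) (⟦comb⟧ _ e _ φ k) 0<ck
          0<φk : 0# < ⟦ φ ⟧ k
          0<φk = [ (λ lt → lt) , (λ φk≤0 → contradiction (nonpos+nonpos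
              (nonneg*nonpos (inj₁ 0<φu) (E.valid k))
              (nonneg*nonpos (inj₁ (neg-pos (E.elsewhere u≢v))) φk≤0)) (<⇒≱ 0<sum)) ]
            (positive? (0# <? ⟦ φ ⟧ k))
            where
            positive? : ∀ {y} → Dec (0# < y) → 0# < y ⊎ y ≤ 0#
            positive? (yes 0<y) = inj₁ 0<y
            positive? (no ¬0<y) = inj₂ (≮⇒≥ ¬0<y)
          higher : ⟦ e ⟧ u * ⟦ φ ⟧ k < ⟦ e ⟧ k * ⟦ φ ⟧ u
          higher = x-y<0⇒x<y (subst (_< 0#)
            (solve 4 (λ a b c d → :- (a :* b :+ (:- c) :* d) := c :* d :+ :- (b :* a)) refl
              (⟦ φ ⟧ u) (⟦ e ⟧ k) (⟦ e ⟧ u) (⟦ φ ⟧ k))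
            (neg-neg 0<sum))
        decide : Dec (u ≡ v) → WalkIn (λ i → 0# < ⟦ φ ⟧ i) u v
        decide (yes refl) = stop u , 0<φu ∷ []
        decide (no u≢v) = continue u≢v (improve c cu≡0 v 0<cv)
          where
          cu≡0 : Tight c u
          cu≡0 = trans (⟦comb⟧ _ e _ φ u) (trans
            (solve 2 (λ a b → a :* b :+ (:- b) :* a := a :* b :+ :- (a :* b)) refl (⟦ φ ⟧ u) (⟦ e ⟧ u))
            (-‿inverseʳ _))
          -- `e` vanishes at `v`, leaving the product of `- ⟦ e ⟧ u` and `⟦ φ ⟧ v`; so an improving
          -- edge exists at every `u` other than `v`.
          0<cv : 0# < ⟦ c ⟧ v
          0<cv = subst (0# <_) (sym (trans (⟦comb⟧ _ e _ φ v) (trans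
            (cong (_+ - ⟦ e ⟧ u * ⟦ φ ⟧ v) (trans (cong (⟦ φ ⟧ u *_) E.tight) (zeroʳ _))) (+-identityˡ _))))
            (*-pos (neg-pos (E.elsewhere u≢v)) 0<φv)

  -- The ends are listed separately because they may lie on the hyperplane itself.
  Above : Functional → Fin n → Fin n → Fin n → Set
  Above φ s t i = i ≡ s ⊎ i ≡ t ⊎ 0# < ⟦ φ ⟧ i

  opaque
    through : ∀ φ s t → 0# ≤ ⟦ φ ⟧ s → 0# ≤ ⟦ φ ⟧ t → ∀ j → 0# < ⟦ φ ⟧ j → WalkIn (Above φ s t) s t
    through φ s t 0≤φs 0≤φt j 0<φj = fromStart 0≤φs
      where
      widen : ∀ {u v} → WalkIn (λ i → 0# < ⟦ φ ⟧ i) u v → WalkIn (Above φ s t) u v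
      widen (w , qs) = w , All.map (inj₂ ∘ inj₂) qs
      toEnd : ∀ u → 0# < ⟦ φ ⟧ u → 0# ≤ ⟦ φ ⟧ t → WalkIn (Above φ s t) u t
      toEnd u 0<φu (inj₁ 0<φt) = widen (climb φ u t 0<φu 0<φt)
      toEnd u 0<φu (inj₂ 0≡φt) =
        let k , 0<φk , edge = improve φ (sym 0≡φt) j 0<φj
        in snoc (widen (climb φ u k 0<φu 0<φk)) (Edge-sym edge) (inj₂ (inj₁ refl))
      fromStart : 0# ≤ ⟦ φ ⟧ s → WalkIn (Above φ s t) s t
      fromStart (inj₁ 0<φs) = toEnd s 0<φs 0≤φt
      fromStart (inj₂ 0≡φs) =
        let k , 0<φk , edge = improve φ (sym 0≡φs) j 0<φj
            w , qs = toEnd k 0<φk 0≤φt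
        in step s edge w , inj₁ refl ∷ qs

  -- The witness `below` excludes the whole polytope and also serves as the vertex that `through`
  -- needs on the open side.
  record Proper (u : Functional) : Set where
    field
      valid : Valid u
      below : ∃ λ j → ⟦ u ⟧ j < 0#

  linkAcross : ∀ {x s₁ t₁ s₂ t₂} → Apart x s₁ t₁ s₂ t₂ → ∀ φ → Tight φ x → Tight φ s₁ → Tight φ t₁ →
               0# ≤ ⟦ φ ⟧ s₂ → 0# ≤ ⟦ φ ⟧ t₂ → (∃ λ j → 0# < ⟦ φ ⟧ j) → (∃ λ j → ⟦ φ ⟧ j < 0#) →
               Linked x s₁ t₁ s₂ t₂
  linkAcross {x} {s₁} {t₁} {s₂} {t₂} apart φ φx φs₁ φt₁ 0≤φs₂ 0≤φt₂ (j , 0<φj) (k , φk<0) =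
    link (through (negate φ) s₁ t₁ (0≤-φ φs₁) (0≤-φ φt₁) k (subst (0# <_) (sym (⟦negate⟧ φ k)) (neg-pos φk<0)))
         (through φ s₂ t₂ 0≤φs₂ 0≤φt₂ j 0<φj) disjoint ¬above₁ ¬above₂
    where
    open Apart apart
    0≤-φ : ∀ {i} → Tight φ i → 0# ≤ ⟦ negate φ ⟧ i
    0≤-φ {i} φi≡0 = inj₂ (sym (trans (⟦negate⟧ φ i) (trans (cong -_ φi≡0) -0#≈0#)))
    negative : ∀ {i} → 0# < ⟦ negate φ ⟧ i → ⟦ φ ⟧ i < 0#
    negative {i} lt = 0<-⇒<0 (subst (0# <_) (⟦negate⟧ φ i) lt)
    disjoint : ∀ {i} → Above (negate φ) s₁ t₁ i → ¬ Above φ s₂ t₂ i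
    disjoint (inj₁ refl) (inj₁ s₁≡s₂)               = s₁≢s₂ s₁≡s₂
    disjoint (inj₁ refl) (inj₂ (inj₁ s₁≡t₂))        = s₁≢t₂ s₁≡t₂
    disjoint (inj₁ refl) (inj₂ (inj₂ 0<φ))          = 0<⇒≢0 0<φ φs₁
    disjoint (inj₂ (inj₁ refl)) (inj₁ t₁≡s₂)        = t₁≢s₂ t₁≡s₂
    disjoint (inj₂ (inj₁ refl)) (inj₂ (inj₁ t₁≡t₂)) = t₁≢t₂ t₁≡t₂
    disjoint (inj₂ (inj₁ refl)) (inj₂ (inj₂ 0<φ))   = 0<⇒≢0 0<φ φt₁
    disjoint (inj₂ (inj₂ φ<0)) (inj₁ refl)          = <⇒≱ (negative φ<0) 0≤φs₂
    disjoint (inj₂ (inj₂ φ<0)) (inj₂ (inj₁ refl))   = <⇒≱ (negative φ<0) 0≤φt₂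
    disjoint (inj₂ (inj₂ φ<0)) (inj₂ (inj₂ 0<φ))    = <-irrefl (<-trans (negative φ<0) 0<φ)
    ¬above₁ : ¬ Above (negate φ) s₁ t₁ x
    ¬above₁ (inj₁ x≡s₁)        = x≢s₁ x≡s₁
    ¬above₁ (inj₂ (inj₁ x≡t₁)) = x≢t₁ x≡t₁
    ¬above₁ (inj₂ (inj₂ φ<0))  = <⇒≢ (negative φ<0) φx
    ¬above₂ : ¬ Above φ s₂ t₂ x
    ¬above₂ (inj₁ x≡s₂)        = x≢s₂ x≡s₂
    ¬above₂ (inj₂ (inj₁ x≡t₂)) = x≢t₂ x≡t₂
    ¬above₂ (inj₂ (inj₂ 0<φ))  = 0<⇒≢0 0<φ φx

  opaque
    -- Four linear conditions on five coefficients have a nonzero solution, whatever the position of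
    -- the points.
    hyperplane : ∀ a b c d → ∃ λ φ → Nonzero φ × Tight φ a × Tight φ b × Tight φ c × Tight φ d
    hyperplane a b c d = extract (kernel 5 rows)
      where
      rows : List Functional
      rows = homogenise a ∷ homogenise b ∷ homogenise c ∷ homogenise d ∷ []
      extract : Kernel 5 rows → ∃ λ φ → Nonzero φ × Tight φ a × Tight φ b × Tight φ c × Tight φ d
      extract (inj₁ (φ , φ≢0 , φa ∷ φb ∷ φc ∷ φd ∷ [])) =
        φ , φ≢0 , trans (⟦⟧-dot φ a) φa , trans (⟦⟧-dot φ b) φb , trans (⟦⟧-dot φ c) φc , trans (⟦⟧-dot φ d) φd
      extract (inj₂ (_ , s≤s (s≤s (s≤s (s≤s ())))))

  tight-negate : ∀ φ {i} → Tight φ i → Tight (negate φ) i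
  tight-negate φ {i} φi≡0 = trans (⟦negate⟧ φ i) (trans (cong -_ φi≡0) -0#≈0#)

  opaque
    -- At most one of `s₂`, `t₂` is off the hyperplane, so `φ` or its negative is nonnegative at
    -- both. If `φ` takes both signs this orientation gives the linkage; otherwise one of the two
    -- functionals supports the polytope, properly because `φ` is nonzero.
    linkOrSupport : ∀ {x s₁ t₁ s₂ t₂} → Apart x s₁ t₁ s₂ t₂ → ∀ φ → Nonzero φ →
                    Tight φ x → Tight φ s₁ → Tight φ t₁ → Tight φ s₂ ⊎ Tight φ t₂ →
                    Linked x s₁ t₁ s₂ t₂ ⊎ (∃ λ ψ → Proper ψ × (∀ {i} → Tight φ i → Tight ψ i))
    linkOrSupport {x} {s₁} {t₁} {s₂} {t₂} apart φ φ≢0 φx φs₁ φt₁ φs₂⊎φt₂ =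
      decide (any? (λ j → 0# <? ⟦ φ ⟧ j)) (any? (λ j → ⟦ φ ⟧ j <? 0#))
      where
      positive : ∀ {i} → ⟦ φ ⟧ i < 0# → 0# < ⟦ negate φ ⟧ i
      positive {i} lt = subst (0# <_) (sym (⟦negate⟧ φ i)) (neg-pos lt)
      negative : ∀ {i} → 0# < ⟦ φ ⟧ i → ⟦ negate φ ⟧ i < 0#
      negative {i} lt = subst (_< 0#) (sym (⟦negate⟧ φ i)) (neg-neg lt)
      ¬tight : ∃ λ i → ¬ Tight φ i
      ¬tight = nonzero⇒¬tight φ x φ≢0
      Both : Functional → Set
      Both χ = 0# ≤ ⟦ χ ⟧ s₂ × 0# ≤ ⟦ χ ⟧ t₂
      oneSign : ∀ {i} → Dec (0# ≤ ⟦ φ ⟧ i) → 0# ≤ ⟦ φ ⟧ i ⊎ 0# ≤ ⟦ negate φ ⟧ i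
      oneSign (yes 0≤φi) = inj₁ 0≤φi
      oneSign (no ¬0≤φi) = inj₂ (inj₁ (positive (≰⇒> ¬0≤φi)))
        where
        ≰⇒> : ∀ {y z} → ¬ y ≤ z → z < y
        ≰⇒> {y} {z} y≰z with compare y z
        ... | tri< y<z _ _ = contradiction (inj₁ y<z) y≰z
        ... | tri≈ _ y≡z _ = contradiction (inj₂ y≡z) y≰z
        ... | tri> _ _ z<y = z<y
      tight⇒0≤ : ∀ χ {i} → Tight χ i → 0# ≤ ⟦ χ ⟧ i
      tight⇒0≤ χ = inj₂ ∘ sym
      both : Tight φ s₂ ⊎ Tight φ t₂ → Both φ ⊎ Both (negate φ)
      both (inj₁ φs₂) = Sum.map (tight⇒0≤ φ φs₂ ,_) (tight⇒0≤ (negate φ) (tight-negate φ φs₂) ,_)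
                          (oneSign (0# ≤? ⟦ φ ⟧ t₂))
      both (inj₂ φt₂) = Sum.map (_, tight⇒0≤ φ φt₂) (_, tight⇒0≤ (negate φ) (tight-negate φ φt₂))
                          (oneSign (0# ≤? ⟦ φ ⟧ s₂))
      decide : Dec (∃ λ j → 0# < ⟦ φ ⟧ j) → Dec (∃ λ j → ⟦ φ ⟧ j < 0#) →
               Linked x s₁ t₁ s₂ t₂ ⊎ (∃ λ ψ → Proper ψ × (∀ {i} → Tight φ i → Tight ψ i))
      decide (yes (j , 0<φj)) (yes (k , φk<0)) = inj₁ ([
        (λ (0≤s₂ , 0≤t₂) → linkAcross apart φ φx φs₁ φt₁ 0≤s₂ 0≤t₂ (j , 0<φj) (k , φk<0)) ,
        (λ (0≤s₂ , 0≤t₂) → linkAcross apart (negate φ) (tight-negate φ φx) (tight-negate φ φs₁) (tight-negate φ φt₁)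
                             0≤s₂ 0≤t₂ (k , positive φk<0) (j , negative 0<φj)) ] (both φs₂⊎φt₂))
      decide (no none) _ = inj₂
        (φ , record { valid = valid ; below = proj₁ ¬tight , valid∧¬tight⇒<0 valid (proj₂ ¬tight) } , id)
        where
        valid : Valid φ
        valid i = ≮⇒≥ λ 0<φi → none (i , 0<φi)
      decide (yes (j , 0<φj)) (no none) = inj₂
        (negate φ , record { valid = valid ; below = j , negative 0<φj } , tight-negate φ)
        where
        valid : Valid (negate φ)
        valid i = ≮⇒≥ λ 0<-φi → none (i , 0<-⇒<0 (subst (0# <_) (⟦negate⟧ φ i) 0<-φi))

  -- Facets containing a given proper face

  record Enlargement (u : Functional) : Set where
    field
      w      : Functional
      proper : Proper w
      ⊆w     : ∀ {i} → Tight u i → Tight w i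
      gained : ∃ λ i → Tight w i × ¬ Tight u i

  unit : Fin 5 → Functional
  unit k = insertAt (λ _ → 0#) k 1#

  dot-unit : ∀ u k → dot u (unit k) ≡ u k
  dot-unit u k = begin
    dot u (unit k)                              ≡⟨ dot-punchIn k u (unit k) ⟩
    u k * unit k k + dot (u ∘ punchIn k) (unit k ∘ punchIn k)
      ≡⟨ cong₂ _+_ (cong (u k *_) (insertAt-lookup (λ _ → 0#) k 1#))
           (trans (dot-comm (u ∘ punchIn k) (unit k ∘ punchIn k))
             (dot-zero (u ∘ punchIn k) (insertAt-punchIn (λ _ → 0#) k 1#))) ⟩
    u k * 1# + 0#                               ≡⟨ trans (+-identityʳ _) (*-identityʳ _) ⟩
    u k                                         ∎
    where open ≡-Reasoning

  -- The touched vertex is new because `g` is positive there but zero on the face of `u`. The face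
  -- stays proper because coordinate `k` of the rotated functional is `α` times `u k`, as `g k`
  -- vanishes.
  enlargeTowards : ∀ {u} k → u k ≢ 0# → Proper u → ∀ g → g k ≡ 0# → (∀ {i} → Tight u i → Tight g i) →
                   ∀ j → 0# < ⟦ g ⟧ j → Enlargement u
  enlargeTowards {u} k uk≢0 proper g gk≡0 u⊆g j 0<gj =
    fromRotation (rotateTowards u g (Proper.valid proper) pos⇒neg j 0<gj)
    where
    pos⇒neg : ∀ i → 0# < ⟦ g ⟧ i → ⟦ u ⟧ i < 0#
    pos⇒neg i 0<gi = valid∧¬tight⇒<0 (Proper.valid proper) (0<⇒≢0 0<gi ∘ u⊆g)
    fromRotation : Rotation u g → Enlargement u
    fromRotation R = record
      { w = R.rotated
      ; proper = record { valid = R.valid ; below = proj₁ ¬tight , valid∧¬tight⇒<0 R.valid (proj₂ ¬tight) }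
      ; ⊆w = λ t → R.tight-both t (u⊆g t)
      ; gained = proj₁ R.touch , proj₂ (proj₂ R.touch) , 0<⇒≢0 (proj₁ (proj₂ R.touch)) ∘ u⊆g
      }
      where
      module R = Rotation R
      ¬tight = nonzero⇒¬tight R.rotated j (k , λ eq → uk≢0 (x*y≡0⇒y≡0 (0<⇒≢0 R.0<α)
        (trans (sym (trans (cong (λ z → R.α * u k + R.β * z) gk≡0)
                 (trans (cong (R.α * u k +_) (zeroʳ R.β)) (+-identityʳ _)))) eq)))

  -- A proper face is a facet exactly when the functionals vanishing on it are the multiples of u;
  -- modulo u, such a functional can be normalised to vanish in a coordinate k with u k ≢ 0.
  facetOrEnlarge : ∀ u → Proper u → IsFacet p (Tight u) ⊎ Enlargement u
  facetOrEnlarge u proper = pick (any? (λ k → ¬? (u k ≟ 0#)))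
    where
    pick : Dec (Nonzero u) → IsFacet p (Tight u) ⊎ Enlargement u
    pick (no u≡0) = contradiction
      (trans (⟦⟧-dot u j) (dot-zero (homogenise j) λ k → decidable-stable (u k ≟ 0#) λ uk≢0 → u≡0 (k , uk≢0)))
      (<⇒≢ (proj₂ (Proper.below proper)))
      where j = proj₁ (Proper.below proper)
    pick (yes (k , uk≢0)) = fromKernel (kernel 5 rows)
      where
      rows : List Functional
      rows = unit k ∷ map homogenise (filter (tight? u) (allFin n))
      fromKernel : Kernel 5 rows → IsFacet p (Tight u) ⊎ Enlargement u
      fromKernel (inj₁ (g , g≢0 , g·unit≡0 ∷ kills)) =
        inj₂ (bySign (nonzero⇒¬tight g (proj₁ (Proper.below proper)) g≢0))
        where
        gk≡0 : g k ≡ 0#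
        gk≡0 = trans (sym (dot-unit g k)) g·unit≡0
        u⊆g : ∀ {i} → Tight u i → Tight g i
        u⊆g {i} ui = trans (⟦⟧-dot g i)
          (All.lookup kills (∈-map⁺ homogenise (∈-filter⁺ (tight? u) (∈-allFin i) ui)))
        bySign : (∃ λ i → ¬ Tight g i) → Enlargement u
        bySign (i , gi≢0) with compare (⟦ g ⟧ i) 0#
        ... | tri≈ _ gi≡0 _ = contradiction gi≡0 gi≢0
        ... | tri> _ _ 0<gi = enlargeTowards k uk≢0 proper g gk≡0 u⊆g i 0<gi
        ... | tri< gi<0 _ _ = enlargeTowards k uk≢0 proper (negate g) (trans (cong -_ gk≡0) -0#≈0#)
                (tight-negate g ∘ u⊆g) i (subst (0# <_) (sym (⟦negate⟧ g i)) (neg-pos gi<0))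
      fromKernel (inj₂ (trivial , _)) = inj₁
        ( toFace u (Proper.valid proper) (λ i → mk⇔ (λ t → t) (λ t → t))
        , (proj₁ (Proper.below proper) , <⇒≢ (proj₂ (Proper.below proper)))
        , λ T isFace u⊆T → maximal T (fromFace isFace) u⊆T )
        where
        maximal : ∀ T → (∃ λ w → Valid w × (∀ i → T i ⇔ Tight w i)) → (∀ i → Tight u i → T i) →
                  (∀ i → T i → Tight u i) ⊎ (∀ i → T i)
        maximal T (w , _ , T⇔w) u⊆T = byCoordinate (w k ≟ 0#)
          where
          z : Functional
          z = comb (u k) w (- w k) u
          zk≡0 : z k ≡ 0#
          zk≡0 = trans (solve 2 (λ a b → a :* b :+ (:- b) :* a := a :* b :+ :- (a :* b)) refl (u k) (w k))
            (-‿inverseʳ _)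
          z-tight : ∀ {i} → Tight u i → dot z (homogenise i) ≡ 0#
          z-tight {i} ui = trans (sym (⟦⟧-dot z i)) (trans (⟦comb⟧ (u k) w (- w k) u i) (trans
            (cong₂ _+_ (trans (cong (u k *_) (Equivalence.to (T⇔w i) (u⊆T i ui))) (zeroʳ _))
                       (trans (cong (- w k *_) ui) (zeroʳ _))) (+-identityˡ 0#)))
          z≡0 : ∀ l → z l ≡ 0#
          z≡0 = trivial z (trans (dot-unit z k) zk≡0 ∷
            Allₚ.map⁺ (All.map (λ {i} → z-tight {i}) (Allₚ.all-filter (tight? u) (allFin n))))
          proportional : ∀ i → u k * ⟦ w ⟧ i ≡ w k * ⟦ u ⟧ i
          proportional i = x-y≡0⇒x≡y (trans
            (solve 4 (λ a b c d → a :* b :+ :- (c :* d) := a :* b :+ (:- c) :* d) refl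
              (u k) (⟦ w ⟧ i) (w k) (⟦ u ⟧ i))
            (trans (sym (⟦comb⟧ (u k) w (- w k) u i)) (trans (⟦⟧-dot z i) (dot-zero (homogenise i) z≡0))))
          -- By proportionality, if `w k` is zero then `w` vanishes at every vertex; otherwise `w`
          -- and `u` have the same zeros.
          byCoordinate : Dec (w k ≡ 0#) → (∀ i → T i → Tight u i) ⊎ (∀ i → T i)
          byCoordinate (yes wk≡0) = inj₂ λ i → Equivalence.from (T⇔w i) (x*y≡0⇒y≡0 uk≢0
            (trans (proportional i) (trans (cong (_* ⟦ u ⟧ i) wk≡0) (zeroˡ _))))
          byCoordinate (no wk≢0) = inj₁ λ i Ti → x*y≡0⇒y≡0 wk≢0
            (trans (sym (proportional i)) (trans (cong (u k *_) (Equivalence.to (T⇔w i) Ti)) (zeroʳ _)))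

  opaque
    facetAbove : ∀ u → Proper u → ∃ λ w → Proper w × (∀ {i} → Tight u i → Tight w i) × IsFacet p (Tight w)
    facetAbove u proper = go u proper (⊃-wellFounded _)
      where
      go : ∀ u → Proper u → Acc _⊃_ (tightSet u) →
           ∃ λ w → Proper w × (∀ {i} → Tight u i → Tight w i) × IsFacet p (Tight w)
      go u proper (acc rec) = continue (facetOrEnlarge u proper)
        where
        continue : IsFacet p (Tight u) ⊎ Enlargement u →
                   ∃ λ w → Proper w × (∀ {i} → Tight u i → Tight w i) × IsFacet p (Tight w)
        continue (inj₁ isFacet) = u , proper , (λ t → t) , isFacet
        continue (inj₂ enlargement) =
          let i , wi , ¬ui = gained
              w′ , proper′ , w⊆w′ , isFacet = go w proper-w (rec (⊂-tabulate (tight? u) (tight? w) ⊆w i wi ¬ui))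
          in w′ , proper′ , w⊆w′ ∘ ⊆w , isFacet
          where open Enlargement enlargement renaming (proper to proper-w)

-- Detours and symmetries of the 3-cube

module Cube where

  Corner : Set
  Corner = Vec Bool 3

  flip : Fin 3 → Corner → Corner
  flip j v = updateAt v j not

  _≟ᵛ_ : (u v : Corner) → Dec (u ≡ v)
  _≟ᵛ_ = ≡-dec Bool._≟_

  lookup-ext : ∀ {n} (u v : Vec Bool n) → (∀ l → lookup u l ≡ lookup v l) → u ≡ v
  lookup-ext []      []      _  = refl
  lookup-ext (a ∷ u) (b ∷ v) eq = cong₂ _∷_ (eq zero) (lookup-ext u v (eq ∘ suc))

  flip-at : ∀ j v → lookup (flip j v) j ≡ not (lookup v j)
  flip-at j v = lookup∘updateAt j v

  flip-off : ∀ {l j} v → l ≢ j → lookup (flip j v) l ≡ lookup v l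
  flip-off {l} {j} v l≢j = lookup∘updateAt′ l j l≢j v

  ≢⇒≡not : ∀ {a b} → a ≢ b → a ≡ not b
  ≢⇒≡not {false} {false} a≢b = contradiction refl a≢b
  ≢⇒≡not {false} {true}  _   = refl
  ≢⇒≡not {true}  {false} _   = refl
  ≢⇒≡not {true}  {true}  a≢b = contradiction refl a≢b

  flip-≢ : ∀ j v → v ≢ flip j v
  flip-≢ j v eq = not-¬ refl (trans (cong (λ u → lookup u j) eq) (flip-at j v))

  Agrees : (Fin 3 → Maybe Bool) → Corner → Set
  Agrees σ v = ∀ j c → σ j ≡ just c → lookup v j ≡ c

  edgeDirection : Fin 3 → Corner → Fin 3 → Maybe Bool
  edgeDirection j v l with l ≟ᶠ j
  ... | yes _ = nothing
  ... | no _  = just (lookup v l)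

  edge-face : ∀ j u v → (v ≡ u ⊎ v ≡ flip j u) ⇔ Agrees (edgeDirection j u) v
  edge-face j u v = mk⇔ to from
    where
    to : v ≡ u ⊎ v ≡ flip j u → Agrees (edgeDirection j u) v
    to v∈ l c eq with l ≟ᶠ j
    to (inj₁ refl) l c refl | no _   = refl
    to (inj₂ refl) l c refl | no l≢j = flip-off u l≢j
    off : Agrees (edgeDirection j u) v → ∀ l → l ≢ j → lookup v l ≡ lookup u l
    off agrees l l≢j with l ≟ᶠ j | agrees l (lookup u l)
    ... | yes l≡j | _     = contradiction l≡j l≢j
    ... | no _    | agree = agree refl
    from : Agrees (edgeDirection j u) v → v ≡ u ⊎ v ≡ flip j u
    from agrees with lookup v j Bool.≟ lookup u j
    ... | yes same = inj₁ (lookup-ext v u at)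
      where
      at : ∀ l → lookup v l ≡ lookup u l
      at l with l ≟ᶠ j
      ... | yes refl = same
      ... | no l≢j   = off agrees l l≢j
    ... | no differ = inj₂ (lookup-ext v (flip j u) at)
      where
      at : ∀ l → lookup v l ≡ lookup (flip j u) l
      at l with l ≟ᶠ j
      ... | yes refl = trans (≢⇒≡not differ) (sym (flip-at j u))
      ... | no l≢j   = trans (off agrees l l≢j) (sym (flip-off u l≢j))

  open DecMembership _≟ᵛ_ using (_∈?_)

  data Detour (avoid : List Corner) : Corner → Corner → Set where
    done : ∀ {v} → v ∉ avoid → Detour avoid v v
    move : ∀ {v t} → v ∉ avoid → ∀ j → Detour avoid (flip j v) t → Detour avoid v t

  weaken : ∀ {u avoid s t} → Detour (u ∷ avoid) s t → Detour avoid s t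
  weaken (done v∉)     = done (v∉ ∘ there)
  weaken (move v∉ j d) = move (v∉ ∘ there) j (weaken d)

  -- Depth-first search in which each visited corner becomes forbidden. The type gives soundness
  -- only; that a detour is found whenever one is needed is checked by evaluation.
  search : ℕ → ∀ avoid s t → Maybe (Detour avoid s t)
  search zero avoid s t = nothing
  search (suc fuel) avoid s t with s ∈? avoid
  ... | yes _ = nothing
  ... | no s∉ with s ≟ᵛ t
  ...   | yes refl = just (done s∉)
  ...   | no _ = try zero <∣> try (suc zero) <∣> try (suc (suc zero))
    where
    try : Fin 3 → Maybe (Detour avoid s t)
    try j = Maybe.map (move s∉ j ∘ weaken) (search fuel (s ∷ avoid) (flip j s) t)

  ∀? : ∀ {n} {P : Vec Bool n → Set} → (∀ v → Dec (P v)) → Dec (∀ v → P v)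
  ∀? {zero}  P? = map′ (λ { p [] → p }) (λ p → p []) (P? [])
  ∀? {suc n} P? = map′ (λ { (f , t) (false ∷ v) → f v ; (f , t) (true ∷ v) → t v })
                       (λ p → (λ v → p (false ∷ v)) , (λ v → p (true ∷ v)))
                       (∀? (λ v → P? (false ∷ v)) ×-dec ∀? (λ v → P? (true ∷ v)))

  -- Stands for `x`: translating the cube brings any corner here, so only the four ends have to be
  -- enumerated.
  origin : Corner
  origin = false ∷ false ∷ false ∷ []

  -- Depth 5 loses nothing: no corner is visited twice, and removing three distinct corners from the
  -- cube leaves five.
  Detours : Corner → Corner → Corner → Corner → Bool
  Detours s₁ t₁ s₂ t₂ =
    is-just (search 5 (origin ∷ s₁ ∷ t₁ ∷ []) s₂ t₂) ∨ is-just (search 5 (origin ∷ s₂ ∷ t₂ ∷ []) s₁ t₁)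

  -- Three vertices separate the 3-cube only if they are the neighbours of a fourth one, and
  -- {x, s₁, t₁}, {x, s₂, t₂} cannot both be the neighbourhood of a vertex of the other pair:
  -- those two vertices would form a triangle with x.
  opaque
    detours : ∀ s₁ → s₁ ≢ origin → ∀ t₁ → t₁ ≢ origin → t₁ ≢ s₁ →
              ∀ s₂ → s₂ ≢ origin → s₂ ≢ s₁ → s₂ ≢ t₁ →
              ∀ t₂ → t₂ ≢ origin → t₂ ≢ s₁ → t₂ ≢ t₁ → t₂ ≢ s₂ → T (Detours s₁ t₁ s₂ t₂)
    detours = toWitness {a? =
      ∀? λ s₁ → (s₁ ≢? origin) →-dec ∀? λ t₁ → (t₁ ≢? origin) →-dec (t₁ ≢? s₁) →-dec
      ∀? λ s₂ → (s₂ ≢? origin) →-dec (s₂ ≢? s₁) →-dec (s₂ ≢? t₁) →-dec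
      ∀? λ t₂ → (t₂ ≢? origin) →-dec (t₂ ≢? s₁) →-dec (t₂ ≢? t₁) →-dec (t₂ ≢? s₂) →-dec T? (Detours s₁ t₁ s₂ t₂)} tt
      where
      _≢?_ : (u v : Corner) → Dec (u ≢ v)
      u ≢? v = ¬? (u ≟ᵛ v)

  detour : ∀ {s₁ t₁ s₂ t₂} → T (Detours s₁ t₁ s₂ t₂) →
           Detour (origin ∷ s₁ ∷ t₁ ∷ []) s₂ t₂ ⊎ Detour (origin ∷ s₂ ∷ t₂ ∷ []) s₁ t₁
  detour {s₁} {t₁} {s₂} {t₂} found
    with search 5 (origin ∷ s₁ ∷ t₁ ∷ []) s₂ t₂ | search 5 (origin ∷ s₂ ∷ t₂ ∷ []) s₁ t₁
  ... | just d  | _      = inj₁ d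
  ... | nothing | just d = inj₂ d

  -- Translation by `u`, an automorphism of the cube: it is an involution, commutes with flips and
  -- takes `origin` to `u`.
  _⊕_ : ∀ {n} → Vec Bool n → Vec Bool n → Vec Bool n
  _⊕_ = zipWith _xor_

  ⊕-cancel : ∀ {n} (u v : Vec Bool n) → u ⊕ (u ⊕ v) ≡ v
  ⊕-cancel []      []      = refl
  ⊕-cancel (a ∷ u) (b ∷ v) = cong₂ _∷_ (trans (sym (xor-assoc a a b)) (cong (_xor b) (xor-same a))) (⊕-cancel u v)

  ⊕-flip : ∀ {n} (u : Vec Bool n) j v → u ⊕ updateAt v j not ≡ updateAt (u ⊕ v) j not
  ⊕-flip (a ∷ u) zero    (b ∷ v) = cong (_∷ (u ⊕ v)) (sym (not-distribʳ-xor a b))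
  ⊕-flip (a ∷ u) (suc j) (b ∷ v) = cong ((a xor b) ∷_) (⊕-flip u j v)

  -- Three faces of the cube through one corner

  Fixed : (Fin 3 → Maybe Bool) → Fin 3 → Set
  Fixed σ i = ∃ λ c → σ i ≡ just c

  fixed? : ∀ σ i → Dec (Fixed σ i)
  fixed? σ i with σ i
  ... | just c  = yes (c , refl)
  ... | nothing = no λ ()

  agree-at : ∀ {σ i} u v → Agrees σ u → Agrees σ v → Fixed σ i → lookup u i ≡ lookup v i
  agree-at {i = i} u v u∈ v∈ (c , eq) = trans (u∈ i c eq) (sym (v∈ i c eq))

  disagreement : ∀ {σ} x v → Agrees σ x → ¬ Agrees σ v → ∃ λ i → Fixed σ i × lookup v i ≢ lookup x i
  disagreement {σ} x v x∈ v∉ with any? (λ i → fixed? σ i ×-dec ¬? (lookup v i Bool.≟ lookup x i))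
  ... | yes found = found
  ... | no none = contradiction
    (λ i c eq → trans (decidable-stable (lookup v i Bool.≟ lookup x i) λ neq →
      none (i , (c , eq) , neq)) (x∈ i c eq)) v∉

  exhaust : ∀ (i j k : Fin 3) → i ≢ j → i ≢ k → j ≢ k → ∀ l → l ≡ i ⊎ l ≡ j ⊎ l ≡ k
  exhaust = toWitness {a? = all? λ i → all? λ j → all? λ k →
    ¬? (i ≟ᶠ j) →-dec ¬? (i ≟ᶠ k) →-dec ¬? (j ≟ᶠ k) →-dec
    all? λ l → (l ≟ᶠ i) ⊎-dec (l ≟ᶠ j) ⊎-dec (l ≟ᶠ k)} tt

  -- The faces A, B, C through x are forced to be the three squares at x, with s, t, z the
  -- neighbours of x on A ∩ B, A ∩ C, B ∩ C; the corner found is opposite to x in A.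
  fourthCorner : ∀ {A B C x s t z} → Agrees A x → Agrees B x → Agrees C x →
    Agrees A s → Agrees B s → ¬ Agrees C s →
    Agrees A t → Agrees C t → ¬ Agrees B t →
    Agrees B z → Agrees C z → ¬ Agrees A z →
    ∃₂ λ i j → flip i t ≡ flip j s × ¬ Agrees B (flip j s)
  fourthCorner {A} {B} {C} {x} {s} {t} {z} Ax Bx Cx As Bs ¬Cs At Ct ¬Bt Bz Cz ¬Az
    with disagreement x s Cx ¬Cs | disagreement x t Bx ¬Bt | disagreement x z Ax ¬Az
  ... | i , Ci , si≢xi | j , Bj , tj≢xj | k , Ak , zk≢xk = i , j , lookup-ext _ _ meet , outside
    where
    -- `s` lies in `A` and `B`, hence agrees with `x` on every coordinate these fix, but it differs
    -- from `x` at `i`. So neither fixes `i`; the other two inequalities follow in the same way.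
    i≢j : i ≢ j
    i≢j refl = si≢xi (agree-at s x Bs Bx Bj)
    i≢k : i ≢ k
    i≢k refl = si≢xi (agree-at s x As Ax Ak)
    j≢k : j ≢ k
    j≢k refl = tj≢xj (agree-at t x At Ax Ak)
    -- `s` and `t` are `x` flipped at `i` and at `j`: `C` fixes `i` for `t`, `B` fixes `j` for `s`,
    -- and `A` makes both agree at `k`.
    meet : ∀ l → lookup (flip i t) l ≡ lookup (flip j s) l
    meet l with exhaust i j k i≢j i≢k j≢k l
    ... | inj₁ refl = trans (flip-at i t) (trans (cong not (agree-at t x Ct Cx Ci))
                        (trans (sym (≢⇒≡not si≢xi)) (sym (flip-off s i≢j))))
    ... | inj₂ (inj₁ refl) = trans (flip-off t (i≢j ∘ sym)) (trans (≢⇒≡not tj≢xj)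
                        (trans (cong not (sym (agree-at s x Bs Bx Bj))) (sym (flip-at j s))))
    ... | inj₂ (inj₂ refl) = trans (flip-off t (i≢k ∘ sym)) (trans (agree-at t s At As Ak)
                        (sym (flip-off s (j≢k ∘ sym))))
    outside : ¬ Agrees B (flip j s)
    outside By = not-¬ refl (trans (sym (agree-at (flip j s) s By Bs Bj)) (flip-at j s))

-- Linking when a facet contains all five vertices

module Linkage (F : OrderedField) {n : ℕ} (p : Fin n → Geometry.Point F)
               (cubical : Geometry.IsCubical4Polytope F p) where
  open OrderedField F
  open Geometry F
  open FieldProperties F
  open LinearAlgebra F
  open Optimisation F
  open Polytope F p (proj₁ cubical) (proj₁ (proj₂ cubical))
  open Connectivity F p (proj₁ cubical) (proj₁ (proj₂ cubical))
  open Walks {E = Edge}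
  open Cube
  open CommutativeRing commutativeRing using (+-identityˡ; *-identityˡ)

  -- Only the vertex bijection and the edges of the combinatorial equivalence are kept, so a
  -- translation of the cube has little to preserve.
  record Chart (w : Functional) : Set where
    field
      chart     : Corner → Fin n
      injective : ∀ {u v} → chart u ≡ chart v → u ≡ v
      tight     : ∀ v → Tight w (chart v)
      onto      : ∀ {i} → Tight w i → ∃ λ v → chart v ≡ i
      edge      : ∀ j v → Edge (chart v) (chart (flip j v))

  toChart : ∀ {w} → CubeEquivalent p (Tight w) → Chart w
  toChart {w} (g , injective , tight , onto , _ , toP) = record
    { chart = g ; injective = injective _ _ ; tight = tight ; onto = onto _ ; edge = edge }
    where
    edge : ∀ j u → Edge (g u) (g (flip j u))
    edge j u = flip-≢ j u ∘ injective _ _ , ends (toP _ (inj₂ (edgeDirection j u , edge-face j u)))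
      where
      ends : IsFace p (λ i → ∃ λ v → (v ≡ u ⊎ v ≡ flip j u) × g v ≡ i) →
             IsFace p (λ k → k ≡ g u ⊎ k ≡ g (flip j u))
      ends (a , b , below , S⇔) = a , b , below , λ i → mk⇔
        (Equivalence.to (S⇔ i) ∘ λ { (inj₁ eq) → u , inj₁ refl , sym eq ; (inj₂ eq) → flip j u , inj₂ refl , sym eq })
        ((λ { (_ , inj₁ refl , eq) → inj₁ (sym eq) ; (_ , inj₂ refl , eq) → inj₂ (sym eq) }) ∘ Equivalence.from (S⇔ i))

  recentre : ∀ {w} → Corner → Chart w → Chart w
  recentre u C = record
    { chart     = chart ∘ (u ⊕_)
    ; injective = λ {v} {v′} eq → trans (sym (⊕-cancel u v)) (trans (cong (u ⊕_) (injective eq)) (⊕-cancel u v′))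
    ; tight     = tight ∘ (u ⊕_)
    ; onto      = λ t → let v , eq = onto t in u ⊕ v , trans (cong chart (⊕-cancel u v)) eq
    ; edge      = λ j v → subst (Edge (chart (u ⊕ v)) ∘ chart) (sym (⊕-flip u j v)) (edge j (u ⊕ v))
    }
    where open Chart C

  linkAround : ∀ {w x s₁ t₁ s₂ t₂} → Proper w → Apart x s₁ t₁ s₂ t₂ → Tight w x → Tight w s₁ → Tight w t₁ →
               WalkIn (λ i → Tight w i × i ∉ x ∷ s₁ ∷ t₁ ∷ []) s₂ t₂ → Linked x s₁ t₁ s₂ t₂
  linkAround {w} {x} {s₁} {t₁} proper apart wx ws₁ wt₁ inside =
    link (through (negate w) s₁ t₁ (nonneg ws₁) (nonneg wt₁) (proj₁ (Proper.below proper))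
           (subst (0# <_) (sym (⟦negate⟧ w _)) (neg-pos (proj₂ (Proper.below proper)))))
         inside
         (λ { (inj₁ refl) (_ , ∉) → ∉ (there (here refl))
            ; (inj₂ (inj₁ refl)) (_ , ∉) → ∉ (there (there (here refl)))
            ; (inj₂ (inj₂ 0<-w)) (wi , _) → off 0<-w wi })
         (λ { (inj₁ x≡s₁) → Apart.x≢s₁ apart x≡s₁
            ; (inj₂ (inj₁ x≡t₁)) → Apart.x≢t₁ apart x≡t₁
            ; (inj₂ (inj₂ 0<-w)) → off 0<-w wx })
         (λ (_ , ∉) → ∉ (here refl))
    where
    nonneg : ∀ {i} → Tight w i → 0# ≤ ⟦ negate w ⟧ i
    nonneg wi = inj₂ (sym (tight-negate w wi))
    off : ∀ {i} → 0# < ⟦ negate w ⟧ i → ¬ Tight w i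
    off 0<-w wi = 0<⇒≢0 0<-w (tight-negate w wi)

  walkAlong : ∀ {w avoid s t} (C : Chart w) → Detour avoid s t → let open Chart C in
              WalkIn (λ i → Tight w i × i ∉ map chart avoid) (chart s) (chart t)
  walkAlong {w} {avoid} C d = walk d
    where
    open Chart C
    off : ∀ {v} → v ∉ avoid → chart v ∉ map chart avoid
    off v∉ gv∈ with ∈-map⁻ chart gv∈
    ... | u , u∈ , eq = v∉ (subst (_∈ avoid) (sym (injective eq)) u∈)
    walk : ∀ {s t} → Detour avoid s t → WalkIn (λ i → Tight w i × i ∉ map chart avoid) (chart s) (chart t)
    walk (done {v} v∉) = stop _ , (tight v , off v∉) ∷ []
    walk (move {v} v∉ j d) =
      let w′ , qs = walk d in step _ (edge j v) w′ , (tight v , off v∉) ∷ qs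

  linkAtOrigin : ∀ {w} → Proper w → (C : Chart w) → let open Chart C in ∀ s₁ t₁ s₂ t₂ →
                 Apart (chart origin) (chart s₁) (chart t₁) (chart s₂) (chart t₂) →
                 Linked (chart origin) (chart s₁) (chart t₁) (chart s₂) (chart t₂)
  linkAtOrigin proper C s₁ t₁ s₂ t₂ apart =
    [ (λ d → linkAround proper apart (tight origin) (tight s₁) (tight t₁) (walkAlong C d))
    , (λ d → swapPairs (linkAround proper (swapApart apart) (tight origin) (tight s₂) (tight t₂) (walkAlong C d)))
    ] (detour {s₁} {t₁} {s₂} {t₂} (detours
        s₁ (≢′ x≢s₁) t₁ (≢′ x≢t₁) (≢′ s₁≢t₁) s₂ (≢′ x≢s₂) (≢′ s₁≢s₂) (≢′ t₁≢s₂)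
        t₂ (≢′ x≢t₂) (≢′ s₁≢t₂) (≢′ t₁≢t₂) (≢′ s₂≢t₂)))
    where
    open Chart C
    open Apart apart
    ≢′ : ∀ {u v} → chart u ≢ chart v → v ≢ u
    ≢′ neq eq = neq (cong chart (sym eq))

  linkInFacet : ∀ {w x s₁ t₁ s₂ t₂} → Proper w → IsFacet p (Tight w) → Apart x s₁ t₁ s₂ t₂ →
                Tight w x → Tight w s₁ → Tight w t₁ → Tight w s₂ → Tight w t₂ → Linked x s₁ t₁ s₂ t₂
  linkInFacet {w} {x} {s₁} {t₁} {s₂} {t₂} proper isFacet apart wx ws₁ wt₁ ws₂ wt₂ =
    inChart (toChart (proj₂ (proj₂ cubical) _ isFacet))
    where
    centred : ∀ {x s₁ t₁ s₂ t₂} (C : Chart w) → let open Chart C in chart origin ≡ x →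
              (∃ λ v → chart v ≡ s₁) → (∃ λ v → chart v ≡ t₁) →
              (∃ λ v → chart v ≡ s₂) → (∃ λ v → chart v ≡ t₂) → Apart x s₁ t₁ s₂ t₂ → Linked x s₁ t₁ s₂ t₂
    centred C refl (s₁ , refl) (t₁ , refl) (s₂ , refl) (t₂ , refl) = linkAtOrigin proper C s₁ t₁ s₂ t₂
    inChart : Chart w → Linked x s₁ t₁ s₂ t₂
    inChart C =
      let u , u≡x = Chart.onto C wx
          C′ = recentre u C
      in centred C′ (trans (cong (Chart.chart C) (zipWith-identityʳ xor-identityʳ u)) u≡x)
           (Chart.onto C′ ws₁) (Chart.onto C′ wt₁) (Chart.onto C′ ws₂) (Chart.onto C′ wt₂) apart

  -- Traces of other faces in a cubical facet

  intersection : ∀ {u w} → Valid u → Valid w → IsFace p (λ i → Tight u i × Tight w i)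
  intersection {u} {w} u-valid w-valid = toFace (comb 1# u 1# w) valid λ i → mk⇔
    (λ (ui , wi) → trans (sum i) (trans (cong₂ _+_ ui wi) (+-identityˡ 0#)))
    (λ eq → split i (trans (sym (sum i)) eq))
    where
    sum : ∀ i → ⟦ comb 1# u 1# w ⟧ i ≡ ⟦ u ⟧ i + ⟦ w ⟧ i
    sum i = trans (⟦comb⟧ 1# u 1# w i) (cong₂ _+_ (*-identityˡ _) (*-identityˡ _))
    valid : Valid (comb 1# u 1# w)
    valid i = subst (_≤ 0#) (sym (sum i)) (nonpos+nonpos (u-valid i) (w-valid i))
    split : ∀ i → ⟦ u ⟧ i + ⟦ w ⟧ i ≡ 0# → Tight u i × Tight w i
    split i eq with u-valid i
    ... | inj₁ ui<0 = contradiction eq (<⇒≢ (neg+nonpos ui<0 (w-valid i)))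
    ... | inj₂ ui≡0 = ui≡0 , trans (sym (+-identityˡ _)) (trans (cong (_+ ⟦ w ⟧ i) (sym ui≡0)) eq)

  -- Each of `A`, `B`, `C` meets the facet in a face, nonempty because of `x`, hence in a face of
  -- the cube given by a partial assignment; `fourthCorner` applies to the three. That `y` avoids
  -- `B` is what later separates the two paths.
  squareCorner : ∀ {w A B C x s t z} → CubeEquivalent p (Tight w) → Valid w → Valid A → Valid B → Valid C →
    Tight w x → Tight A x → Tight B x → Tight C x →
    Tight w s → Tight A s → Tight B s → ¬ Tight C s →
    Tight w t → Tight A t → Tight C t → ¬ Tight B t →
    Tight w z → Tight B z → Tight C z → ¬ Tight A z →
    ∃ λ y → Tight w y × ¬ Tight B y × Edge s y × Edge y t
  squareCorner {w} {A} {B} {C} cube w-valid A-valid B-valid C-valid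
    wx Ax Bx Cx ws As Bs ¬Cs wt At Ct ¬Bt wz Bz Cz ¬Az =
    locate (onto wx) (onto ws) (onto wt) (onto wz) Ax Bx Cx As Bs ¬Cs At Ct ¬Bt Bz Cz ¬Az
    where
    open Chart (toChart cube)
    Trace : Functional → Set
    Trace D = ∃ λ σ → ∀ v → Tight D (chart v) ⇔ Agrees σ v
    trace : ∀ D {i} → Valid D → Tight w i → Tight D i → Trace D
    trace D {i} D-valid wi Di =
      fromCubeFace (proj₁ (proj₂ (proj₂ (proj₂ (proj₂ cube)))) _ (intersection w-valid D-valid) (λ _ → proj₁))
        (onto wi)
      where
      fromCubeFace : IsCubeFace (λ v → Tight w (chart v) × Tight D (chart v)) → (∃ λ v → chart v ≡ i) → Trace D
      fromCubeFace (inj₁ empty) (v , refl) = contradiction (wi , Di) (empty v)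
      fromCubeFace (inj₂ (σ , T⇔σ)) _ = σ , λ v → mk⇔
        (λ Dv → Equivalence.to (T⇔σ v) (tight v , Dv)) (proj₂ ∘ Equivalence.from (T⇔σ v))
    locate : ∀ {x s t z} → (∃ λ v → chart v ≡ x) → (∃ λ v → chart v ≡ s) → (∃ λ v → chart v ≡ t) →
      (∃ λ v → chart v ≡ z) → Tight A x → Tight B x → Tight C x → Tight A s → Tight B s → ¬ Tight C s →
      Tight A t → Tight C t → ¬ Tight B t → Tight B z → Tight C z → ¬ Tight A z →
      ∃ λ y → Tight w y × ¬ Tight B y × Edge s y × Edge y t
    locate (x′ , refl) (s′ , refl) (t′ , refl) (z′ , refl) Ax Bx Cx As Bs ¬Cs At Ct ¬Bt Bz Cz ¬Az =
      build (fourthCorner {x = x′} {z = z′} (on trA Ax) (on trB Bx) (on trC Cx)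
                          (on trA As) (on trB Bs) (off trC ¬Cs)
                          (on trA At) (on trC Ct) (off trB ¬Bt) (on trB Bz) (on trC Cz) (off trA ¬Az))
      where
      trA = trace A A-valid (tight x′) Ax
      trB = trace B B-valid (tight x′) Bx
      trC = trace C C-valid (tight x′) Cx
      on : ∀ {D v} (tr : Trace D) → Tight D (chart v) → Agrees (proj₁ tr) v
      on {v = v} (σ , D⇔σ) = Equivalence.to (D⇔σ v)
      off : ∀ {D v} (tr : Trace D) → ¬ Tight D (chart v) → ¬ Agrees (proj₁ tr) v
      off {v = v} (σ , D⇔σ) ¬Dv = ¬Dv ∘ Equivalence.from (D⇔σ v)
      build : (∃₂ λ i j → flip i t′ ≡ flip j s′ × ¬ Agrees (proj₁ trB) (flip j s′)) →
              ∃ λ y → Tight w y × ¬ Tight B y × Edge (chart s′) y × Edge y (chart t′)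
      build (i , j , meet , ¬By) =
        chart (flip j s′) , tight _ , ¬By ∘ on trB , edge j s′ ,
        subst (λ v → Edge (chart v) (chart t′)) meet (Edge-sym (edge i t′))

  -- Four facets, each missing one end

  record FacetMissing (a b c d m : Fin n) : Set₁ where
    field
      w       : Functional
      proper  : Proper w
      isFacet : IsFacet p (Tight w)
      tight-a : Tight w a
      tight-b : Tight w b
      tight-c : Tight w c
      tight-d : Tight w d
      ¬tight  : ¬ Tight w m

  -- `L` is the linkage sought. It is obtained at once if the hyperplane cuts the polytope, and also
  -- if the facet found happens to contain `m`.
  facetMissing : ∀ {L : Set} {a b c d m} →
    (∀ φ → Nonzero φ → Tight φ a → Tight φ b → Tight φ c → Tight φ d →
      L ⊎ (∃ λ ψ → Proper ψ × (∀ {i} → Tight φ i → Tight ψ i))) →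
    (∀ {w} → Proper w → IsFacet p (Tight w) → Tight w a → Tight w b → Tight w c → Tight w d → Tight w m → L) →
    L ⊎ FacetMissing a b c d m
  facetMissing {L} {a} {b} {c} {d} {m} support inFacet = fromHyperplane (hyperplane a b c d)
    where
    fromFacet : ∀ {w} → Proper w → IsFacet p (Tight w) → Tight w a → Tight w b → Tight w c → Tight w d →
                Dec (Tight w m) → L ⊎ FacetMissing a b c d m
    fromFacet proper isFacet wa wb wc wd (yes wm) = inj₁ (inFacet proper isFacet wa wb wc wd wm)
    fromFacet proper isFacet wa wb wc wd (no ¬wm) = inj₂ record
      { proper = proper ; isFacet = isFacet
      ; tight-a = wa ; tight-b = wb ; tight-c = wc ; tight-d = wd ; ¬tight = ¬wm }
    fromSupport : ∀ {ψ} → Tight ψ a → Tight ψ b → Tight ψ c → Tight ψ d →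
                  (∃ λ w → Proper w × (∀ {i} → Tight ψ i → Tight w i) × IsFacet p (Tight w)) →
                  L ⊎ FacetMissing a b c d m
    fromSupport ψa ψb ψc ψd (w , proper , ψ⊆w , isFacet) =
      fromFacet proper isFacet (ψ⊆w ψa) (ψ⊆w ψb) (ψ⊆w ψc) (ψ⊆w ψd) (tight? w m)
    fromHyperplane : (∃ λ φ → Nonzero φ × Tight φ a × Tight φ b × Tight φ c × Tight φ d) →
                     L ⊎ FacetMissing a b c d m
    fromHyperplane (φ , φ≢0 , φa , φb , φc , φd) =
      [ inj₁ , (λ (ψ , proper , φ⊆ψ) →
        fromSupport (φ⊆ψ φa) (φ⊆ψ φb) (φ⊆ψ φc) (φ⊆ψ φd) (facetAbove ψ proper)) ]
      (support φ φ≢0 φa φb φc φd)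

  missing-t₂ : ∀ {x s₁ t₁ s₂ t₂} → Apart x s₁ t₁ s₂ t₂ → Linked x s₁ t₁ s₂ t₂ ⊎ FacetMissing x s₁ t₁ s₂ t₂
  missing-t₂ apart = facetMissing
    (λ φ φ≢0 φx φs₁ φt₁ φs₂ → linkOrSupport apart φ φ≢0 φx φs₁ φt₁ (inj₁ φs₂))
    (λ proper isFacet → linkInFacet proper isFacet apart)

  missing-s₂ : ∀ {x s₁ t₁ s₂ t₂} → Apart x s₁ t₁ s₂ t₂ → Linked x s₁ t₁ s₂ t₂ ⊎ FacetMissing x s₁ t₁ t₂ s₂
  missing-s₂ apart = facetMissing
    (λ φ φ≢0 φx φs₁ φt₁ φt₂ → linkOrSupport apart φ φ≢0 φx φs₁ φt₁ (inj₂ φt₂))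
    (λ proper isFacet wx ws₁ wt₁ wt₂ ws₂ → linkInFacet proper isFacet apart wx ws₁ wt₁ ws₂ wt₂)

  -- In the cube of `f₁`, the facets `f₂`, `f₃`, `f₄` omit `s₂`, `t₁`, `s₁` respectively, which
  -- gives a corner `y₁` joining `s₁` to `t₁` off the facet of `f₃`; symmetrically `y₂` joins `s₂`
  -- to `t₂` off the facet of `f₁`. The facet of `f₃` contains `x`, `s₂`, `t₂`, `y₂` and that of
  -- `f₁` contains `x`, `s₁`, `t₁`, `y₁`, so the paths are disjoint and miss `x`.
  linkAtSimplex : ∀ {x s₁ t₁ s₂ t₂} → Apart x s₁ t₁ s₂ t₂ →
    FacetMissing x s₁ t₁ s₂ t₂ → FacetMissing x s₁ t₁ t₂ s₂ →
    FacetMissing x s₂ t₂ s₁ t₁ → FacetMissing x s₂ t₂ t₁ s₁ → Linked x s₁ t₁ s₂ t₂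
  linkAtSimplex {x} {s₁} {t₁} {s₂} {t₂} apart f₁ f₂ f₃ f₄ = combine
    (squareCorner (cube F₁.isFacet) (valid F₁.proper) (valid F₂.proper) (valid F₃.proper) (valid F₄.proper)
      F₁.tight-a F₂.tight-a F₃.tight-a F₄.tight-a
      F₁.tight-b F₂.tight-b F₃.tight-d F₄.¬tight
      F₁.tight-c F₂.tight-c F₄.tight-d F₃.¬tight
      F₁.tight-d F₃.tight-b F₄.tight-b F₂.¬tight)
    (squareCorner (cube F₃.isFacet) (valid F₃.proper) (valid F₄.proper) (valid F₁.proper) (valid F₂.proper)
      F₃.tight-a F₄.tight-a F₁.tight-a F₂.tight-a
      F₃.tight-b F₄.tight-b F₁.tight-d F₂.¬tight
      F₃.tight-c F₄.tight-c F₂.tight-d F₁.¬tight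
      F₃.tight-d F₁.tight-b F₂.tight-b F₄.¬tight)
    where
    module F₁ = FacetMissing f₁
    module F₂ = FacetMissing f₂
    module F₃ = FacetMissing f₃
    module F₄ = FacetMissing f₄
    open Apart apart
    open Proper using (valid)
    cube : ∀ {w} → IsFacet p (Tight w) → CubeEquivalent p (Tight w)
    cube = proj₂ (proj₂ cubical) _
    via : ∀ {s y t} → Edge s y → Edge y t → WalkIn (λ i → i ≡ s ⊎ i ≡ y ⊎ i ≡ t) s t
    via e e′ = step _ e (step _ e′ (stop _)) , inj₁ refl ∷ inj₂ (inj₁ refl) ∷ inj₂ (inj₂ refl) ∷ []
    combine : (∃ λ y → Tight F₁.w y × ¬ Tight F₃.w y × Edge s₁ y × Edge y t₁) →
              (∃ λ y → Tight F₃.w y × ¬ Tight F₁.w y × Edge s₂ y × Edge y t₂) → Linked x s₁ t₁ s₂ t₂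
    combine (y₁ , F₁y₁ , ¬F₃y₁ , e₁ , e₁′) (y₂ , F₃y₂ , ¬F₁y₂ , e₂ , e₂′) =
      link (via e₁ e₁′) (via e₂ e₂′)
        (λ { (inj₁ refl)        (inj₁ s₁≡s₂)        → s₁≢s₂ s₁≡s₂
           ; (inj₁ refl)        (inj₂ (inj₁ refl))  → ¬F₁y₂ F₁.tight-b
           ; (inj₁ refl)        (inj₂ (inj₂ s₁≡t₂)) → s₁≢t₂ s₁≡t₂
           ; (inj₂ (inj₁ refl)) (inj₁ refl)         → ¬F₃y₁ F₃.tight-b
           ; (inj₂ (inj₁ refl)) (inj₂ (inj₁ refl))  → ¬F₃y₁ F₃y₂
           ; (inj₂ (inj₁ refl)) (inj₂ (inj₂ refl))  → ¬F₃y₁ F₃.tight-c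
           ; (inj₂ (inj₂ refl)) (inj₁ t₁≡s₂)        → t₁≢s₂ t₁≡s₂
           ; (inj₂ (inj₂ refl)) (inj₂ (inj₁ refl))  → ¬F₁y₂ F₁.tight-c
           ; (inj₂ (inj₂ refl)) (inj₂ (inj₂ t₁≡t₂)) → t₁≢t₂ t₁≡t₂ })
        (λ { (inj₁ x≡s₁) → x≢s₁ x≡s₁ ; (inj₂ (inj₁ refl)) → ¬F₃y₁ F₃.tight-a ; (inj₂ (inj₂ x≡t₁)) → x≢t₁ x≡t₁ })
        (λ { (inj₁ x≡s₂) → x≢s₂ x≡s₂ ; (inj₂ (inj₁ refl)) → ¬F₁y₂ F₁.tight-a ; (inj₂ (inj₂ x≡t₂)) → x≢t₂ x≡t₂ })

  linked : ∀ {x s₁ t₁ s₂ t₂} → Apart x s₁ t₁ s₂ t₂ → Linked x s₁ t₁ s₂ t₂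
  linked apart =
    [ id , (λ f₁ →
    [ id , (λ f₂ →
    [ swapPairs , (λ f₃ →
    [ swapPairs , linkAtSimplex apart f₁ f₂ f₃ ]
    (missing-s₂ (swapApart apart))) ]
    (missing-t₂ (swapApart apart))) ]
    (missing-s₂ apart)) ]
    (missing-t₂ apart)

theorem27 : (F : OrderedField) (n : ℕ) (p : Fin n → Geometry.Point F) →
    Geometry.IsCubical4Polytope F p →
    (s₁ t₁ s₂ t₂ x : Fin n) →
    s₁ ≢ t₁ → s₁ ≢ s₂ → s₁ ≢ t₂ → s₁ ≢ x →
    t₁ ≢ s₂ → t₁ ≢ t₂ → t₁ ≢ x →
    s₂ ≢ t₂ → s₂ ≢ x → t₂ ≢ x →
    Σ (Path (Geometry.Adj F p) s₁ t₁) λ L₁ →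
    Σ (Path (Geometry.Adj F p) s₂ t₂) λ L₂ →
    Disjoint (verts (Σ.proj₁ L₁)) (verts (Σ.proj₁ L₂)) ×
    x ∉ verts (Σ.proj₁ L₁) × x ∉ verts (Σ.proj₁ L₂)
theorem27 F n p cubical s₁ t₁ s₂ t₂ x s₁≢t₁ s₁≢s₂ s₁≢t₂ s₁≢x t₁≢s₂ t₁≢t₂ t₁≢x s₂≢t₂ s₂≢x t₂≢x =
  Linkage.linked F p cubical record
    { x≢s₁ = s₁≢x ∘ sym ; x≢t₁ = t₁≢x ∘ sym ; x≢s₂ = s₂≢x ∘ sym ; x≢t₂ = t₂≢x ∘ sym
    ; s₁≢t₁ = s₁≢t₁ ; s₁≢s₂ = s₁≢s₂ ; s₁≢t₂ = s₁≢t₂ ; t₁≢s₂ = t₁≢s₂ ; t₁≢t₂ = t₁≢t₂ ; s₂≢t₂ = s₂≢t₂ }
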